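{- Let $r\ge 1$, $s\ge 2$, and let $P_1(\underline{x}),\ldots,P_s(\underline{x})\in\mathbb{Z}[\underline{x}]$, $\underline{x}=(x_1,\ldots,x_r)$, be nonzero coprime polynomials. For $\underline{n}\in\mathbb{Z}^r$ put $d_{\underline{n}}=\gcd(P_1(\underline{n}),\ldots,P_s(\underline{n}))$. Then the set $\mathcal{D}=\{d_{\underline{n}}\mid \underline{n}\in\mathbb{Z}^r\}$ is stable under gcd and lcm, i.e., if $d,d'\in\mathcal{D}$ then $\gcd(d,d')\in\mathcal{D}$ and $\operatorname{lcm}(d,d')\in\mathcal{D}$.
   Context: Polynomials $P_1,\ldots,P_s\in\mathbb{Z}[\underline{x}]$ are called coprime if they are coprime over $\mathbb{Q}$: no polynomial $D\in\mathbb{Q}[\underline{x}]$ with $\deg D>0$ divides all of $P_1,\ldots,P_s$ in $\mathbb{Q}[\underline{x}]$. The gcd of integers is the nonnegative one, with the convention $\gcd(0,\ldots,0)=0$ (so $d_{\underline{n}}=0$ when all $P_i(\underline{n})=0$). -}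

module Defs where

open import Algebra.Bundles.Raw using (RawRing)
import Algebra.Definitions.RawSemiring as RawSemiringDefinitions
open import Data.Integer.Base as ℤ using (ℤ; 0ℤ)
open import Data.Integer.GCD using (gcd)
open import Data.List.Base as List using (List; []; _∷_)
open import Data.Nat.Base using (ℕ; zero; suc; _≤_; _>_)
open import Data.Product.Base using (∃-syntax; _×_)
open import Data.Rational.Base as ℚ using (ℚ)
open import Data.Rational.Literals using (fromℤ)
open import Data.Vec.Base as Vec using (Vec; []; _∷_)
open import Data.Vec.Functional using (Vector; foldr)
open import Level using (Level; 0ℓ)
open import Relation.Binary.PropositionalEquality.Core using (_≡_)
open import Relation.Nullary.Negation.Core using (¬_)
open import Relation.Unary using (Pred)

private
  variable
    a b ℓ ℓ′ : Level

-- The ring R[x].  A polynomial is its list of coefficients, constant term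
-- first; trailing zeros are allowed, so equality is equality of all
-- coefficients and not equality of lists.

module Univariate (R : RawRing a ℓ) where
  open RawRing R

  coefficient : List Carrier → ℕ → Carrier
  coefficient []      _       = 0#
  coefficient (c ∷ p) zero    = c
  coefficient (c ∷ p) (suc i) = coefficient p i

  add : List Carrier → List Carrier → List Carrier
  add []      q       = q
  add (c ∷ p) []      = c ∷ p
  add (c ∷ p) (d ∷ q) = (c + d) ∷ add p q

  mul : List Carrier → List Carrier → List Carrier
  mul []      q = []
  mul (c ∷ p) q = add (List.map (c *_) q) (0# ∷ mul p q)

  rawRing : RawRing a ℓ
  rawRing = record
    { Carrier = List Carrier
    ; _≈_     = λ p q → ∀ i → coefficient p i ≈ coefficient q i
    ; _+_     = add
    ; _*_     = mul
    ; -_      = List.map (-_)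
    ; 0#      = []
    ; 1#      = 1# ∷ []
    }

-- The ring R[x₁,…,xᵣ], built as R[x₂,…,xᵣ][x₁]: the outermost list is
-- indexed by the exponent of x₁.

polynomialRing : RawRing a ℓ → ℕ → RawRing a ℓ
polynomialRing R zero    = R
polynomialRing R (suc r) = Univariate.rawRing (polynomialRing R r)

Polynomial : RawRing a ℓ → ℕ → Set a
Polynomial R r = RawRing.Carrier (polynomialRing R r)

module Multivariate (R : RawRing a ℓ) where
  open RawRing R using (Carrier; _+_; _*_; 0#; _≉_)

  coefficient : ∀ r → Polynomial R r → Vec ℕ r → Carrier
  coefficient zero    c []      = c
  coefficient (suc r) p (i ∷ e) =
    coefficient r (Univariate.coefficient (polynomialRing R r) p i) e

  evaluate : ∀ r → Polynomial R r → Vec Carrier r → Carrier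
  evaluate zero    c []       = c
  evaluate (suc r) p (x ∷ xs) =
    List.foldr (λ c y → evaluate r c xs + x * y) 0# p

  -- Total degree.  The zero polynomial has no degree.

  HasDegree : ∀ r → Polynomial R r → ℕ → Set ℓ
  HasDegree r p d =
    (∃[ e ] coefficient r p e ≉ 0# × Vec.sum e ≡ d) ×
    (∀ e → coefficient r p e ≉ 0# → Vec.sum e ≤ d)

mapCoefficients : (R : RawRing a ℓ) (S : RawRing b ℓ′) →
                  (RawRing.Carrier R → RawRing.Carrier S) →
                  ∀ r → Polynomial R r → Polynomial S r
mapCoefficients R S f zero    c = f c
mapCoefficients R S f (suc r) p = List.map (mapCoefficients R S f r) p

ℤ[x] ℚ[x] : ℕ → RawRing 0ℓ 0ℓ
ℤ[x] = polynomialRing ℤ.+-*-rawRing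
ℚ[x] = polynomialRing ℚ.+-*-rawRing

ℤPolynomial ℚPolynomial : ℕ → Set
ℤPolynomial = Polynomial ℤ.+-*-rawRing
ℚPolynomial = Polynomial ℚ.+-*-rawRing

toℚ[x] : ∀ r → ℤPolynomial r → ℚPolynomial r
toℚ[x] = mapCoefficients ℤ.+-*-rawRing ℚ.+-*-rawRing fromℤ

NonZeroPolynomial : ∀ r → ℤPolynomial r → Set
NonZeroPolynomial r p = p ≉ 0#
  where open RawRing (ℤ[x] r)

CoprimePolynomials : ∀ r {s} → Vector (ℤPolynomial r) s → Set
CoprimePolynomials r P =
  ¬ (∃[ D ] (∃[ d ] d > 0 × HasDegree r D d) × (∀ i → D ∣ toℚ[x] r (P i)))
  where
  open Multivariate ℚ.+-*-rawRing using (HasDegree)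
  open RawSemiringDefinitions (RawRing.rawSemiring (ℚ[x] r)) using (_∣_)

gcdOfValues : ∀ r {s} → Vector (ℤPolynomial r) s → Vec ℤ r → ℤ
gcdOfValues r P n = foldr gcd 0ℤ (λ i → evaluate r (P i) n)
  where open Multivariate ℤ.+-*-rawRing using (evaluate)

𝒟 : ∀ r {s} → Vector (ℤPolynomial r) s → Pred ℤ 0ℓ
𝒟 r P d = ∃[ n ] gcdOfValues r P n ≡ d

{- If d_b = 0 or d_c = 0, their gcd and lcm are again d_b and d_c.  Otherwise
   let B ≠ 0 be a multiple of d_b d_c and of a suitable β depending on the Pᵢ
   only, and split B² = N₁ N₂ into coprime factors such that d_b has the
   higher p-adic valuation at the primes p ∣ N₁ where the valuations of d_b
   and d_c differ, and d_c has it at those p ∣ N₂.  If n ≡ b mod N₁ and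
   n ≡ c mod N₂ then gcd(d_n, B²) = lcm(d_b, d_c); with b and c exchanged it
   is gcd(d_b, d_c).  Hence it is enough to find, in a given residue class
   mod B², an n such that every prime dividing d_n divides B.

   Such an n is found by induction on r.  View the Pᵢ as polynomials in x₁
   over R = ℤ[x₂,…,xᵣ].  Since R is factorial and the Pᵢ are coprime, they are
   coprime over the fraction field of R, so the ideal they generate contains
   some nonzero δ ∈ R.  The coefficients of the Pᵢ are coprime in R, so by
   induction there is y in the given class with δ(y) ≠ 0 such that every
   prime dividing all coefficients at y divides B.  A prime dividing all Pᵢ(x,y)
   divides δ(y), which leaves finitely many primes to avoid; for each of them
   some Pᵢ(·,y) is nonzero mod p, and as β is a multiple of m! for a bound m
   on the number of its coefficients, x can be moved off its roots. -}

module Submission where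

open import Defs
open import Algebra.Bundles using (CommutativeRing; RawRing)
open import Algebra.Definitions.RawMagma using (_,_)
open import Algebra.Structures using (IsCommutativeRing)
open import Data.Empty using (⊥; ⊥-elim)
open import Data.Fin.Base using (zero; suc)
open import Data.Integer.Base as ℤ using (ℤ; +_; 0ℤ; 1ℤ)
import Data.Integer.Divisibility.Signed as Signed
import Data.Integer.Properties as ℤ
import Data.Integer.Tactic.RingSolver as ℤ-Solver
open import Data.List.Base as List using (List; []; _∷_; length; concat)
import Data.List.Properties as List
open import Data.List.Relation.Unary.All as All using (All; []; _∷_)
import Data.List.Relation.Unary.All.Properties as All
open import Data.List.Relation.Unary.AllPairs using (AllPairs; []; _∷_)
import Data.List.Relation.Unary.AllPairs.Properties as AllPairs
open import Data.List.Relation.Unary.Any as Any using (Any; here; there)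
import Data.List.Relation.Unary.Any.Properties as Any
open import Data.Nat.Base as ℕ using (ℕ; zero; suc; z≤n; s≤s; _≥_; _!)
import Data.Nat.Coprimality as Coprimality
import Data.Nat.Divisibility as ℕ
import Data.Nat.GCD as ℕ
open import Data.Nat.Induction using (<-wellFounded)
import Data.Nat.LCM as ℕ
import Data.Nat.Properties as ℕ
open import Data.Nat.Primality 
  using (Prime; Irreducible; prime[2]; irreducible⇒prime; prime⇒irreducible; euclidsLemma;
         prime⇒nonZero; ¬prime[1])
open import Data.Nat.Primality.Factorisation
  using (factorise; module PrimeFactorisation; factorisationHasAllPrimeFactors)
open import Data.Product.Base using (_,_; _×_; ∃-syntax; ∃₂; proj₁; proj₂)
open import Data.Rational.Base as ℚ using (0ℚ)
open import Data.Rational.Literals using (fromℤ)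
import Data.Rational.Properties as ℚ
import Data.Rational.Unnormalised.Base as ℚᵘ
import Data.Rational.Unnormalised.Properties as ℚᵘ
open import Data.Sum.Base as Sum using (_⊎_; inj₁; inj₂)
open import Data.Vec.Base as Vec using (Vec; []; _∷_)
open import Data.Vec.Functional using (Vector; foldr)
open import Data.Vec.Relation.Binary.Pointwise.Inductive as Pointwise using (Pointwise; []; _∷_)
open import Function.Base using (_∘_)
open import Induction.WellFounded using (Acc; acc; WellFounded; module Subrelation)
open import Level as Level using (Level; 0ℓ; _⊔_)
import Relation.Binary.Construct.On as On
open import Relation.Binary.Definitions using (tri<; tri≈; tri>)
open import Relation.Binary.PropositionalEquality as ≡ using (_≡_)
open import Relation.Binary.Structures using (IsEquivalence)
open import Relation.Nullary.Decidable using (Dec; yes; no; map′; ¬¬-excluded-middle)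
open import Relation.Nullary.Negation using (¬_; contradiction)
open import Relation.Unary using (_∈_)

-- Polynomials over a commutative ring

module PolynomialRing {c ℓ} (R : CommutativeRing c ℓ) where
  open CommutativeRing R
  open Univariate rawRing public using (coefficient; add; mul)
  open import Algebra.Properties.CommutativeSemigroup
    (CommutativeRing.+-commutativeSemigroup R) using (interchange; x∙yz≈y∙xz)
  open import Algebra.Properties.Ring ring using (-0#≈0#)

  -- The coefficientwise equality of Defs unfolds to a function type, from
  -- which the two polynomials cannot be inferred; hence the record.
  infix 4 _≋_
  record _≋_ (p q : List Carrier) : Set ℓ where
    constructor coefficientwise
    field at : ∀ i → coefficient p i ≈ coefficient q i
  open _≋_ public

  scale : Carrier → List Carrier → List Carrier
  scale a = List.map (a *_)

  ≋-isEquivalence : IsEquivalence _≋_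
  ≋-isEquivalence = record
    { refl  = coefficientwise λ _ → refl
    ; sym   = λ p≋q → coefficientwise λ i → sym (at p≋q i)
    ; trans = λ p≋q q≋r → coefficientwise λ i → trans (at p≋q i) (at q≋r i)
    }

  open IsEquivalence ≋-isEquivalence public
    renaming (refl to ≋-refl; sym to ≋-sym; trans to ≋-trans) using ()

  coefficient-add : ∀ p q i →
    coefficient (add p q) i ≈ coefficient p i + coefficient q i
  coefficient-add []      q       i       = sym (+-identityˡ _)
  coefficient-add (a ∷ p) []      i       = sym (+-identityʳ _)
  coefficient-add (a ∷ p) (b ∷ q) zero    = refl
  coefficient-add (a ∷ p) (b ∷ q) (suc i) = coefficient-add p q i

  coefficient-scale : ∀ a p i → coefficient (scale a p) i ≈ a * coefficient p i
  coefficient-scale a []      i       = sym (zeroʳ a)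
  coefficient-scale a (b ∷ p) zero    = refl
  coefficient-scale a (b ∷ p) (suc i) = coefficient-scale a p i

  coefficient-neg : ∀ p i → coefficient (List.map (-_) p) i ≈ - coefficient p i
  coefficient-neg []      i       = sym -0#≈0#
  coefficient-neg (b ∷ p) zero    = refl
  coefficient-neg (b ∷ p) (suc i) = coefficient-neg p i

  ∷-cong : ∀ {a b p q} → a ≈ b → p ≋ q → (a ∷ p) ≋ (b ∷ q)
  ∷-cong a≈b p≋q .at zero    = a≈b
  ∷-cong a≈b p≋q .at (suc i) = at p≋q i

  0∷[]≋[] : (0# ∷ []) ≋ []
  0∷[]≋[] .at zero    = refl
  0∷[]≋[] .at (suc i) = refl

  add-cong : ∀ {p p′ q q′} → p ≋ p′ → q ≋ q′ → add p q ≋ add p′ q′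
  add-cong {p} {p′} {q} {q′} p≋p′ q≋q′ .at i = trans (coefficient-add p q i)
    (trans (+-cong (at p≋p′ i) (at q≋q′ i)) (sym (coefficient-add p′ q′ i)))

  scale-cong : ∀ {a b p q} → a ≈ b → p ≋ q → scale a p ≋ scale b q
  scale-cong {a} {b} {p} {q} a≈b p≋q .at i = trans (coefficient-scale a p i)
    (trans (*-cong a≈b (at p≋q i)) (sym (coefficient-scale b q i)))

  neg-cong : ∀ {p q} → p ≋ q → List.map (-_) p ≋ List.map (-_) q
  neg-cong {p} {q} p≋q .at i = trans (coefficient-neg p i)
    (trans (-‿cong (at p≋q i)) (sym (coefficient-neg q i)))

  add-assoc : ∀ p q r → add (add p q) r ≋ add p (add q r)
  add-assoc p q r .at i = trans (coefficient-add (add p q) r i)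
    (trans (+-congʳ (coefficient-add p q i)) (trans (+-assoc _ _ _)
    (trans (+-congˡ (sym (coefficient-add q r i))) (sym (coefficient-add p _ i)))))

  add-comm : ∀ p q → add p q ≋ add q p
  add-comm p q .at i = trans (coefficient-add p q i)
    (trans (+-comm _ _) (sym (coefficient-add q p i)))

  add-identityʳ : ∀ p → add p [] ≋ p
  add-identityʳ p = add-comm p []

  add-inverseˡ : ∀ p → add (List.map (-_) p) p ≋ []
  add-inverseˡ p .at i = trans (coefficient-add (List.map (-_) p) p i)
    (trans (+-congʳ (coefficient-neg p i)) (-‿inverseˡ _))

  add-interchange : ∀ p q r s → add (add p q) (add r s) ≋ add (add p r) (add q s)
  add-interchange p q r s .at i = trans (coefficient-add (add p q) _ i)
    (trans (+-cong (coefficient-add p q i) (coefficient-add r s i))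
    (trans (interchange _ _ _ _)
    (trans (sym (+-cong (coefficient-add p r i) (coefficient-add q s i)))
           (sym (coefficient-add (add p r) _ i)))))

  add-swap : ∀ p q r → add p (add q r) ≋ add q (add p r)
  add-swap p q r = ≋-trans (≋-sym (add-assoc p q r))
    (≋-trans (add-cong (add-comm p q) ≋-refl) (add-assoc q p r))

  0∷-add : ∀ p q → (0# ∷ add p q) ≋ add (0# ∷ p) (0# ∷ q)
  0∷-add p q = ∷-cong (sym (+-identityˡ 0#)) ≋-refl

  scale-distrib-add : ∀ a p q → scale a (add p q) ≋ add (scale a p) (scale a q)
  scale-distrib-add a p q .at i = trans (coefficient-scale a (add p q) i)
    (trans (*-congˡ (coefficient-add p q i)) (trans (distribˡ _ _ _)
    (trans (sym (+-cong (coefficient-scale a p i) (coefficient-scale a q i)))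
           (sym (coefficient-add (scale a p) _ i)))))

  scale-* : ∀ a b p → scale (a * b) p ≋ scale a (scale b p)
  scale-* a b p .at i = trans (coefficient-scale (a * b) p i)
    (trans (*-assoc _ _ _)
    (trans (*-congˡ (sym (coefficient-scale b p i)))
           (sym (coefficient-scale a (scale b p) i))))

  scale-0 : ∀ p → scale 0# p ≋ []
  scale-0 p .at i = trans (coefficient-scale 0# p i) (zeroˡ _)

  scale-1 : ∀ p → scale 1# p ≋ p
  scale-1 p .at i = trans (coefficient-scale 1# p i) (*-identityˡ _)

  scale-0∷ : ∀ a p → scale a (0# ∷ p) ≋ (0# ∷ scale a p)
  scale-0∷ a p = ∷-cong (zeroʳ a) ≋-refl

  mul-zeroʳ : ∀ p → mul p [] ≋ []
  mul-zeroʳ []      = ≋-refl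
  mul-zeroʳ (a ∷ p) = ≋-trans (∷-cong refl (mul-zeroʳ p)) 0∷[]≋[]

  -- `mul` recurses on its left factor; this is the mirror image, a recursion on the right factor,
  -- and it turns commutativity into an induction.
  mul-∷ʳ : ∀ p b q → mul p (b ∷ q) ≋ add (scale b p) (0# ∷ mul p q)
  mul-∷ʳ []      b q = ≋-sym 0∷[]≋[]
  mul-∷ʳ (a ∷ p) b q = ∷-cong (+-congʳ (*-comm a b))
    (≋-trans (add-cong ≋-refl (mul-∷ʳ p b q)) (add-swap (scale a q) (scale b p) _))

  mul-comm : ∀ p q → mul p q ≋ mul q p
  mul-comm []      q = ≋-sym (mul-zeroʳ q)
  mul-comm (a ∷ p) q = ≋-trans (add-cong ≋-refl (∷-cong refl (mul-comm p q)))
    (≋-sym (mul-∷ʳ q a p))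

  mul-congˡ : ∀ p {q q′} → q ≋ q′ → mul p q ≋ mul p q′
  mul-congˡ []      q≋q′ = ≋-refl
  mul-congˡ (a ∷ p) q≋q′ =
    add-cong (scale-cong refl q≋q′) (∷-cong refl (mul-congˡ p q≋q′))

  mul-congʳ : ∀ q {p p′} → p ≋ p′ → mul p q ≋ mul p′ q
  mul-congʳ q {p} {p′} p≋p′ =
    ≋-trans (mul-comm p q) (≋-trans (mul-congˡ q p≋p′) (mul-comm q p′))

  mul-cong : ∀ {p p′ q q′} → p ≋ p′ → q ≋ q′ → mul p q ≋ mul p′ q′
  mul-cong {p} {p′} {q} p≋p′ q≋q′ = ≋-trans (mul-congʳ q p≋p′) (mul-congˡ p′ q≋q′)

  mul-distribˡ : ∀ p q r → mul p (add q r) ≋ add (mul p q) (mul p r)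
  mul-distribˡ []      q r = ≋-refl
  mul-distribˡ (a ∷ p) q r = ≋-trans
    (add-cong (scale-distrib-add a q r)
      (≋-trans (∷-cong refl (mul-distribˡ p q r)) (0∷-add (mul p q) (mul p r))))
    (add-interchange (scale a q) (scale a r) (0# ∷ mul p q) (0# ∷ mul p r))

  mul-distribʳ : ∀ p q r → mul (add q r) p ≋ add (mul q p) (mul r p)
  mul-distribʳ p q r = ≋-trans (mul-comm (add q r) p) (≋-trans (mul-distribˡ p q r)
    (add-cong (mul-comm p q) (mul-comm p r)))

  mul-0∷ˡ : ∀ p q → mul (0# ∷ p) q ≋ (0# ∷ mul p q)
  mul-0∷ˡ p q = add-cong (scale-0 q) ≋-refl

  mul-scaleˡ : ∀ a p q → mul (scale a p) q ≋ scale a (mul p q)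
  mul-scaleˡ a []      q = ≋-refl
  mul-scaleˡ a (b ∷ p) q = ≋-trans
    (add-cong (scale-* a b q) (≋-trans (∷-cong refl (mul-scaleˡ a p q))
      (≋-sym (scale-0∷ a (mul p q)))))
    (≋-sym (scale-distrib-add a (scale b q) (0# ∷ mul p q)))

  mul-assoc : ∀ p q r → mul (mul p q) r ≋ mul p (mul q r)
  mul-assoc []      q r = ≋-refl
  mul-assoc (a ∷ p) q r = ≋-trans (mul-distribʳ r (scale a q) (0# ∷ mul p q))
    (add-cong (mul-scaleˡ a q r)
      (≋-trans (mul-0∷ˡ (mul p q) r) (∷-cong refl (mul-assoc p q r))))

  mul-const : ∀ a p → mul (a ∷ []) p ≋ scale a p
  mul-const a p = ≋-trans (add-cong ≋-refl 0∷[]≋[]) (add-identityʳ (scale a p))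

  mul-identityˡ : ∀ p → mul (1# ∷ []) p ≋ p
  mul-identityˡ p = ≋-trans (mul-const 1# p) (scale-1 p)

  polynomials-isCommutativeRing : IsCommutativeRing _≋_ add mul (List.map (-_)) [] (1# ∷ [])
  polynomials-isCommutativeRing = record
    { isRing = record
      { +-isAbelianGroup = record
        { isGroup = record
          { isMonoid = record
            { isSemigroup = record
              { isMagma = record { isEquivalence = ≋-isEquivalence ; ∙-cong = add-cong }
              ; assoc = add-assoc
              }
            ; identity = (λ _ → ≋-refl) , add-identityʳ
            }
          ; inverse = add-inverseˡ , λ p → ≋-trans (add-comm p _) (add-inverseˡ p)
          ; ⁻¹-cong = neg-cong
          }
        ; comm = add-comm
        }
      ; *-cong = mul-cong
      ; *-assoc = mul-assoc
      ; *-identity = mul-identityˡ , λ p → ≋-trans (mul-comm p _) (mul-identityˡ p)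
      ; distrib = mul-distribˡ , mul-distribʳ
      }
    ; *-comm = mul-comm
    }

  polynomials : CommutativeRing c ℓ
  polynomials = record { isCommutativeRing = polynomials-isCommutativeRing }

-- Factorial domains

-- Statements about factorisation are classical; they are only used to
-- derive a contradiction, so they take the form of refutations.
module Divisibility {c ℓ} (R : CommutativeRing c ℓ) where
  open CommutativeRing R
  open import Algebra.Properties.Semiring.Divisibility semiring public
    using (_∣_; _∤_; ∣ʳ-refl; ∣ʳ-trans; ∣ʳ-respʳ-≈; ∣ʳ-respˡ-≈; x∣ʳyx; x∣ʳy⇒x∣ʳzy;
           0∣x⇒x≈0; _∣0)
  open import Algebra.Properties.CommutativeSemigroup *-commutativeSemigroup
    using (x∙yz≈y∙zx; xy∙z≈y∙xz; x∙yz≈y∙xz; x∙yz≈yx∙z)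
  open import Algebra.Properties.Ring ring
    using (x[y-z]≈xy-xz; x∙y⁻¹≈ε⇒x≈y; [y-z]x≈yx-zx; -‿distribˡ-*)
  open import Relation.Binary.Reasoning.Setoid setoid

  ∣-+ : ∀ {x y z} → x ∣ y → x ∣ z → x ∣ y + z
  ∣-+ (p , px≈y) (q , qx≈z) = p + q , trans (distribʳ _ p q) (+-cong px≈y qx≈z)

  ∣-*ʳ : ∀ {x y} z → x ∣ y → x ∣ y * z
  ∣-*ʳ z x∣y = ∣ʳ-respʳ-≈ (*-comm z _) (x∣ʳy⇒x∣ʳzy z x∣y)

  ∣-+-cancelˡ : ∀ {x y z} → x ∣ y → x ∣ y + z → x ∣ z
  ∣-+-cancelˡ {x} {y} {z} x∣y x∣y+z = ∣ʳ-respʳ-≈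
    (trans (sym (+-assoc _ y z)) (trans (+-congʳ (-‿inverseˡ y)) (+-identityˡ z)))
    (∣-+ (∣-neg x∣y) x∣y+z)
    where
    ∣-neg : ∀ {x y} → x ∣ y → x ∣ - y
    ∣-neg (q , qx≈y) = - q , trans (sym (-‿distribˡ-* _ _)) (-‿cong qx≈y)

  ∣-unit-* : ∀ {u x y} → u ∣ 1# → x ∣ u * y → x ∣ y
  ∣-unit-* (v , vu≈1) x∣uy = ∣ʳ-respʳ-≈
    (trans (sym (*-assoc v _ _)) (trans (*-congʳ vu≈1) (*-identityˡ _)))
    (x∣ʳy⇒x∣ʳzy v x∣uy)

  -- Substitute `l a - t b` for `a′` in the Bézout relation: this undoes one step of the Euclidean
  -- algorithm.
  reduce-bezout : ∀ {a a′ b g l t u v} → u * a′ + v * b ≈ g → a′ + t * b ≈ l * a →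
                  (u * l) * a + (v - u * t) * b ≈ g
  reduce-bezout {a} {a′} {b} {g} {l} {t} {u} {v} ua′+vb≈g a′+tb≈la = begin
    (u * l) * a + (v - u * t) * b
      ≈⟨ +-cong (*-assoc u l a) ([y-z]x≈yx-zx b v (u * t)) ⟩
    u * (l * a) + (v * b - u * t * b)
      ≈⟨ +-congʳ (*-congˡ a′+tb≈la) ⟨
    u * (a′ + t * b) + (v * b - u * t * b)
      ≈⟨ +-congʳ (trans (distribˡ u a′ _) (+-congˡ (sym (*-assoc u t b)))) ⟩
    u * a′ + u * t * b + (v * b - u * t * b)
      ≈⟨ +-assoc _ _ _ ⟩
    u * a′ + (u * t * b + (v * b - u * t * b))
      ≈⟨ +-congˡ (trans (+-comm _ _) (+-assoc _ _ _)) ⟩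
    u * a′ + (v * b + (- (u * t * b) + u * t * b))
      ≈⟨ +-congˡ (trans (+-congˡ (-‿inverseˡ _)) (+-identityʳ _)) ⟩
    u * a′ + v * b
      ≈⟨ ua′+vb≈g ⟩
    g ∎

  reduce-divisor : ∀ {a a′ b g c l t} → a′ + t * b ≈ l * a → g ∣ c * a′ → g ∣ c * b →
                   g ∣ (l * c) * a
  reduce-divisor {a} {a′} {b} {g} {c} {l} {t} a′+tb≈la g∣ca′ g∣cb = ∣ʳ-respʳ-≈
    (begin
      c * a′ + t * (c * b)  ≈⟨ +-congˡ (x∙yz≈y∙xz t c b) ⟩
      c * a′ + c * (t * b)  ≈⟨ distribˡ c a′ _ ⟨
      c * (a′ + t * b)      ≈⟨ *-congˡ a′+tb≈la ⟩
      c * (l * a)           ≈⟨ x∙yz≈yx∙z c l a ⟩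
      (l * c) * a           ∎)
    (∣-+ g∣ca′ (x∣ʳy⇒x∣ʳzy t g∣cb))

  record IsIrreducible (a : Carrier) : Set (c ⊔ ℓ) where
    field
      a≉0    : a ≉ 0#
      a∤1    : a ∤ 1#
      split : ∀ x y → x * y ≈ a → x ∤ 1# → y ∤ 1# → ⊥

  infix 4 _◁_
  _◁_ : Carrier → Carrier → Set (c ⊔ ℓ)
  b ◁ a = a ≉ 0# × ∃[ x ] x ∤ 1# × x * b ≈ a

  -- Unique factorisation in two halves: the chain condition for divisors, stated as
  -- well-foundedness of `_◁_`, and primality of irreducible elements. The test `≈0?` makes degrees
  -- of polynomials computable.
  record IsFactorial : Set (c ⊔ ℓ) where
    field
      ≈0?               : ∀ a → Dec (a ≈ 0#)
      1≉0               : 1# ≉ 0#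
      *-nonzero         : ∀ {a b} → a ≉ 0# → b ≉ 0# → a * b ≉ 0#
      ◁-wellFounded     : WellFounded _◁_
      irreducible-prime : ∀ {a} x y → IsIrreducible a →
                          a ∣ x * y → a ∤ x → a ∤ y → ⊥

  module Domain (≈0? : ∀ a → Dec (a ≈ 0#))
    (*-nonzero : ∀ {a b} → a ≉ 0# → b ≉ 0# → a * b ≉ 0#) where

    *-cancelˡ : ∀ {a x y} → a ≉ 0# → a * x ≈ a * y → x ≈ y
    *-cancelˡ {a} {x} {y} a≉0 ax≈ay with ≈0? (x - y)
    ... | yes x-y≈0 = x∙y⁻¹≈ε⇒x≈y x y x-y≈0
    ... | no  x-y≉0 = contradiction
      (trans (x[y-z]≈xy-xz a x y) (trans (+-congʳ ax≈ay) (-‿inverseʳ _)))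
      (*-nonzero a≉0 x-y≉0)

    *-nonzero⁻ʳ : ∀ {a x y} → x * y ≈ a → a ≉ 0# → y ≉ 0#
    *-nonzero⁻ʳ xy≈a a≉0 y≈0 = a≉0 (trans (sym xy≈a) (trans (*-congˡ y≈0) (zeroʳ _)))

    *-nonzero⁻ˡ : ∀ {a x y} → x * y ≈ a → a ≉ 0# → x ≉ 0#
    *-nonzero⁻ˡ xy≈a = *-nonzero⁻ʳ (trans (*-comm _ _) xy≈a)

    divide-common-factor : ∀ {π c c′ g g′ q f} → π ≉ 0# → c′ * π ≈ c → g′ * π ≈ g →
      q * g ≈ c * f → q * g′ ≈ c′ * f
    divide-common-factor {π} {c} {c′} {g} {g′} {q} {f} π≉0 c′π≈c g′π≈g qg≈cf =
      *-cancelˡ π≉0 (begin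
        π * (q * g′)   ≈⟨ x∙yz≈y∙zx π q g′ ⟩
        q * (g′ * π)   ≈⟨ *-congˡ g′π≈g ⟩
        q * g          ≈⟨ qg≈cf ⟩
        c * f          ≈⟨ *-congʳ c′π≈c ⟨
        (c′ * π) * f   ≈⟨ xy∙z≈y∙xz c′ π f ⟩
        π * (c′ * f)   ∎)

  module Factorial (isFactorial : IsFactorial) where
    open IsFactorial isFactorial public
    open Domain ≈0? *-nonzero public

    irreducible-factor : ∀ {a} → a ≉ 0# → a ∤ 1# →
                         ¬ ¬ (∃[ π ] IsIrreducible π × π ∣ a)
    irreducible-factor {a} = go (◁-wellFounded a)
      where
      go : ∀ {a} → Acc _◁_ a → a ≉ 0# → a ∤ 1# → ¬ ¬ (∃[ π ] IsIrreducible π × π ∣ a)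
      -- `a` itself is offered as the irreducible element. Should it split as `x * y`, the recursion
      -- finds an irreducible factor of `y`, which divides `a` too.
      go {a} (acc rec) a≉0 a∤1 none = none
        (a , record { a≉0 = a≉0 ; a∤1 = a∤1 ; split = split } , ∣ʳ-refl)
        where
        split : ∀ x y → x * y ≈ a → x ∤ 1# → y ∤ 1# → ⊥
        split x y xy≈a x∤1 y∤1 =
          go (rec (a≉0 , x , x∤1 , xy≈a)) (*-nonzero⁻ʳ xy≈a a≉0) y∤1
            λ (π , irr , π∣y) → none (π , irr , ∣ʳ-trans π∣y (x , xy≈a))

-- Polynomials in one variable over a factorial domain

module FactorialPolynomials
  {r ℓ} (R : CommutativeRing r ℓ) (isFactorial : Divisibility.IsFactorial R) where

  open CommutativeRing R
  open Divisibility R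
  open Factorial isFactorial
  open PolynomialRing R
  module S = CommutativeRing polynomials
  module D = Divisibility polynomials

  Poly : Set r
  Poly = List Carrier

  [_] : Carrier → Poly
  [ a ] = a ∷ []

  coefficient-[]* : ∀ a p i → coefficient ([ a ] S.* p) i ≈ a * coefficient p i
  coefficient-[]* a p i = trans (at (mul-const a p) i) (coefficient-scale a p i)

  []-* : ∀ a b → ([ a ] S.* [ b ]) ≋ [ a * b ]
  []-* a b = mul-const a [ b ]

  -- An exclusive bound for the degree, so that `Bounded p 0` describes the zero polynomial. Since
  -- lists may end in zeros, `length` supplies such a bound but not the degree.
  Bounded : Poly → ℕ → Set ℓ
  Bounded p n = ∀ i → n ℕ.≤ i → coefficient p i ≈ 0#

  bounded-length : ∀ p → Bounded p (List.length p)
  bounded-length []      i       _         = refl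
  bounded-length (a ∷ p) (suc i) (s≤s n≤i) = bounded-length p i n≤i

  bounded-0 : ∀ {p} → Bounded p 0 → p ≋ []
  bounded-0 b .at i = b i z≤n

  bounded-pred : ∀ {p n} → Bounded p (suc n) → coefficient p n ≈ 0# → Bounded p n
  bounded-pred {p} {n} b top i n≤i with ℕ.m≤n⇒m<n∨m≡n n≤i
  ... | inj₁ n<i    = b i n<i
  ... | inj₂ ≡.refl = top

  record HasDegree (p : Poly) (n : ℕ) : Set ℓ where
    constructor _,_
    field
      bounded : Bounded p (suc n)
      top     : coefficient p n ≉ 0#

  degree : ∀ p → (p ≋ []) ⊎ (∃[ n ] HasDegree p n)
  degree p = go (List.length p) (bounded-length p)
    where
    go : ∀ n → Bounded p n → (p ≋ []) ⊎ (∃[ n ] HasDegree p n)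
    go zero    b = inj₁ (bounded-0 {p} b)
    go (suc n) b with ≈0? (coefficient p n)
    ... | yes z = go n (bounded-pred {p} b z)
    ... | no nz = inj₂ (n , (b , nz))

  degree≉0 : ∀ {p n} → HasDegree p n → p S.≉ S.0#
  degree≉0 {n = n} (_ , nz) p≋0 = nz (at p≋0 n)

  degree-unique : ∀ {p q m n} → p ≋ q → HasDegree p m → HasDegree q n → m ≡ n
  degree-unique {m = m} {n} p≋q (bp , tp) (bq , tq) with ℕ.<-cmp m n
  ... | tri< m<n _ _ = contradiction (trans (sym (at p≋q n)) (bp n m<n)) tq
  ... | tri≈ _ m≡n _ = m≡n
  ... | tri> _ _ n<m = contradiction (trans (at p≋q m) (bq m n<m)) tp

  mul-bounded : ∀ p q m n → Bounded p (suc m) → Bounded q (suc n) →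
                Bounded (p S.* q) (suc (m ℕ.+ n)) ×
                coefficient (p S.* q) (m ℕ.+ n) ≈ coefficient p m * coefficient q n
  mul-bounded [] q m n bp bq = (λ _ _ → refl) , sym (zeroˡ _)
  mul-bounded (a ∷ p) q zero n bp bq =
      (λ i n<i → trans (coefficient-aq i) (trans (*-congˡ (bq i n<i)) (zeroʳ a)))
    , coefficient-aq n
    where
    coefficient-aq : ∀ i → coefficient ((a ∷ p) S.* q) i ≈ a * coefficient q i
    coefficient-aq i = trans (at (mul-congʳ q (∷-cong refl p≋0)) i) (coefficient-[]* a q i)
      where
      p≋0 : p ≋ []
      p≋0 .at i = bp (suc i) (s≤s z≤n)
  mul-bounded (a ∷ p) q (suc m) n bp bq = bnd , tp
    where
    ih = mul-bounded p q m n (λ i m<i → bp (suc i) (s≤s m<i)) bq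
    -- Beyond index `n` the summand `scale a q` vanishes, so only the shifted product with the tail
    -- `p` contributes.
    co : ∀ i → n ℕ.< suc i → coefficient ((a ∷ p) S.* q) (suc i) ≈ coefficient (p S.* q) i
    co i n<i = trans (coefficient-add (scale a q) _ (suc i)) (trans
      (+-congʳ (trans (coefficient-scale a q (suc i)) (trans (*-congˡ (bq (suc i) n<i)) (zeroʳ a))))
      (+-identityˡ _))
    bnd : Bounded ((a ∷ p) S.* q) (suc (suc m ℕ.+ n))
    bnd (suc i) (s≤s m+n<i) =
      trans (co i (s≤s (ℕ.≤-trans (ℕ.m≤n+m n m) (ℕ.<⇒≤ m+n<i)))) (proj₁ ih i m+n<i)
    tp = trans (co (m ℕ.+ n) (s≤s (ℕ.m≤n+m n m))) (proj₂ ih)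

  degree-* : ∀ {p q m n} → HasDegree p m → HasDegree q n → HasDegree (p S.* q) (m ℕ.+ n)
  degree-* {p} {q} {m} {n} (bp , tp) (bq , tq) with mul-bounded p q m n bp bq
  ... | b , t = b , λ z → *-nonzero tp tq (trans (sym t) z)

  ¬¬-all : ∀ {a b} {A : Set a} {P : A → Set b} {xs} → All (λ x → ¬ ¬ P x) xs → ¬ ¬ All P xs
  ¬¬-all []         ¬all = ¬all []
  ¬¬-all (¬¬p ∷ ps) ¬all = ¬¬p λ p → ¬¬-all ps λ qs → ¬all (p ∷ qs)

  []-∣ : ∀ {π} p → (∀ i → π ∣ coefficient p i) → [ π ] D.∣ p
  []-∣ {π} p π∣p = let q , qπ≋p = quotients p π∣p in
    q , ≋-trans (mul-comm q [ π ]) (≋-trans (mul-const π q) qπ≋p)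
    where
    quotients : ∀ p → (∀ i → π ∣ coefficient p i) → ∃[ q ] scale π q ≋ p
    quotients []      π∣p = [] , ≋-refl
    quotients (a ∷ p) π∣p = let q , qπ≈a = π∣p 0 ; qs , e = quotients p (π∣p ∘ suc) in
      q ∷ qs , ∷-cong (trans (*-comm π q) qπ≈a) e

  []-∣⁻¹ : ∀ {π p} → [ π ] D.∣ p → ∀ i → π ∣ coefficient p i
  []-∣⁻¹ {π} {p} (q , qπ≋p) i = coefficient q i , trans (*-comm _ π)
    (trans (sym (coefficient-[]* π q i)) (trans (at (mul-comm [ π ] q) i) (at qπ≋p i)))

  []-∣1⁻¹ : ∀ {a} → [ a ] D.∣ S.1# → a ∣ 1#
  []-∣1⁻¹ a∣1 = []-∣⁻¹ a∣1 0

  []-∣1 : ∀ {a} → a ∣ 1# → [ a ] D.∣ S.1#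
  []-∣1 (q , qa≈1) = [ q ] , ≋-trans ([]-* q _) (∷-cong qa≈1 ≋-refl)

  -- Gauss's lemma, by induction on both lists. `π` divides the product `a * b` of the constant
  -- terms. If it divides `a`, then `scale a (b ∷ q)` can be removed from the product and the shift
  -- undone, which leaves `p` times `b ∷ q`; the case of `b` is symmetric.
  gauss : ∀ {π} → (∀ x y → π ∣ x * y → π ∤ x → π ∤ y → ⊥) →
          ∀ p q → [ π ] D.∣ p S.* q → [ π ] D.∤ p → [ π ] D.∤ q → ⊥
  gauss {π} prime []      q       π∣pq π∤p π∤q = π∤p (D._∣0 [ π ])
  gauss {π} prime (a ∷ p) []      π∣pq π∤p π∤q = π∤q (D._∣0 [ π ])
  gauss {π} prime (a ∷ p) (b ∷ q) π∣pq π∤p π∤q =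
    prime a b (∣ʳ-respʳ-≈ (+-identityʳ _) ([]-∣⁻¹ π∣pq 0))
      (λ π∣a → gauss prime p (b ∷ q)
        ([]-∣-0∷⁻¹ _ (D.∣-+-cancelˡ ([]-∣-scale (b ∷ q) π∣a) π∣pq))
        (π∤p ∘ []-∣-∷ p π∣a) π∤q)
      (λ π∣b → gauss prime (a ∷ p) q
        ([]-∣-0∷⁻¹ _ (D.∣-+-cancelˡ ([]-∣-scale (a ∷ p) π∣b)
          (D.∣ʳ-respʳ-≈ (mul-∷ʳ (a ∷ p) b q) π∣pq)))
        π∤p (π∤q ∘ []-∣-∷ q π∣b))
    where
    []-∣-∷ : ∀ {a} p → π ∣ a → [ π ] D.∣ p → [ π ] D.∣ (a ∷ p)
    []-∣-∷ p π∣a π∣p = []-∣ _ λ { zero → π∣a ; (suc i) → []-∣⁻¹ π∣p i }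

    []-∣-scale : ∀ {a} p → π ∣ a → [ π ] D.∣ scale a p
    []-∣-scale {a} p π∣a = []-∣ _ λ i → ∣ʳ-respʳ-≈ (sym (coefficient-scale a p i)) (∣-*ʳ _ π∣a)

    []-∣-0∷⁻¹ : ∀ p → [ π ] D.∣ (0# ∷ p) → [ π ] D.∣ p
    []-∣-0∷⁻¹ p π∣0∷p = []-∣ p ([]-∣⁻¹ π∣0∷p ∘ suc)

  poly-nonzero : ∀ {p q} → p S.≉ S.0# → q S.≉ S.0# → p S.* q S.≉ S.0#
  poly-nonzero {p} {q} p≉0 q≉0 with degree p | degree q
  ... | inj₁ p≋0       | _              = contradiction p≋0 p≉0
  ... | inj₂ _         | inj₁ q≋0       = contradiction q≋0 q≉0
  ... | inj₂ (_ , dp)  | inj₂ (_ , dq)  = degree≉0 (degree-* dp dq)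

  poly-≈0? : ∀ p → Dec (p ≋ [])
  poly-≈0? p with degree p
  ... | inj₁ p≋0      = yes p≋0
  ... | inj₂ (_ , dp) = no (degree≉0 dp)

  []-nonzero : ∀ {a} → a ≉ 0# → [ a ] S.≉ S.0#
  []-nonzero a≉0 [a]≋0 = a≉0 (at [a]≋0 0)

  degree-0 : ∀ {p} → HasDegree p 0 → p ≋ [ coefficient p 0 ]
  degree-0 (b , _) .at zero    = refl
  degree-0 (b , _) .at (suc i) = b (suc i) (s≤s z≤n)

  degree-[] : ∀ {a} → a ≉ 0# → HasDegree [ a ] 0
  degree-[] a≉0 = (λ { (suc i) _ → refl }) , a≉0

  -- Degrees add up, so a cofactor of positive degree lowers the degree. A cofactor of degree zero
  -- is a non-unit constant: it keeps the degree, but the leading coefficient is then properly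
  -- divided in `R`.
  ◁-poly-degree : ∀ {p q n} → HasDegree p n → q D.◁ p → ∃[ m ] HasDegree q m ×
    (m ℕ.< n ⊎ (m ≡ n × coefficient q m ◁ coefficient p n))
  ◁-poly-degree {p} {q} {n} dp (p≉0 , w , w∤1 , wq≋p) with degree q | degree w
  ... | inj₁ q≋0 | _ = contradiction
    (≋-trans (≋-sym wq≋p) (≋-trans (mul-congˡ w q≋0) (mul-zeroʳ w))) p≉0
  ... | inj₂ _   | inj₁ w≋0 = contradiction
    (≋-trans (≋-sym wq≋p) (mul-congʳ q w≋0)) p≉0
  ... | inj₂ (m , dq) | inj₂ (k , dw)
    with degree-unique wq≋p (degree-* dw dq) dp
  ◁-poly-degree {p} {q} dp (p≉0 , w , w∤1 , wq≋p)
    | inj₂ (m , dq) | inj₂ (suc k , dw) | ≡.refl = m , dq , inj₁ (s≤s (ℕ.m≤n+m m k))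
  ◁-poly-degree {p} {q} dp (p≉0 , w , w∤1 , wq≋p)
    | inj₂ (m , dq) | inj₂ (zero , dw) | ≡.refl =
    m , dq , inj₂ (≡.refl , HasDegree.top dp , coefficient w 0 ,
      (λ w₀∣1 → w∤1 (D.∣ʳ-respˡ-≈ (≋-sym (degree-0 dw)) ([]-∣1 w₀∣1))) ,
      trans (sym (coefficient-[]* (coefficient w 0) q m))
        (trans (sym (at (mul-congʳ q (degree-0 dw)) m)) (at wq≋p m)))

  -- Lexicographic induction, first on the degree and then on the leading coefficient under `_◁_`.
  ◁-poly-wellFounded : WellFounded D._◁_
  ◁-poly-wellFounded p with degree p
  ... | inj₁ p≋0      = acc λ (p≉0 , _) → contradiction p≋0 p≉0
  ... | inj₂ (n , dp) = go (<-wellFounded n) (◁-wellFounded _) dp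
    where
    go : ∀ {n p} → Acc ℕ._<_ n → Acc _◁_ (coefficient p n) → HasDegree p n → Acc D._◁_ p
    go {p = p} (acc recₙ) (acc rec) dp = acc λ q◁p → by-cases {p} (◁-poly-degree dp q◁p)
      (λ m<n dq → go (recₙ m<n) (◁-wellFounded _) dq)
      (λ dq lq◁lp → go (acc recₙ) (rec lq◁lp) dq)
      where
      by-cases : ∀ {p q n} → (∃[ m ] HasDegree q m ×
        (m ℕ.< n ⊎ (m ≡ n × coefficient q m ◁ coefficient p n))) →
        (∀ {m} → m ℕ.< n → HasDegree q m → Acc D._◁_ q) →
        (HasDegree q n → coefficient q n ◁ coefficient p n → Acc D._◁_ q) → Acc D._◁_ q
      by-cases (m , dq , inj₁ m<n)              lower same = lower m<n dq
      by-cases (m , dq , inj₂ (≡.refl , lq◁lp)) lower same = same dq lq◁lp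

  Positive : Poly → Set ℓ
  Positive p = ∃[ n ] coefficient p (suc n) ≉ 0#

  constant-or-positive : ∀ {p} → p S.≉ S.0# →
    (∃[ a ] a ≉ 0# × p ≋ [ a ]) ⊎ Positive p
  constant-or-positive {p} p≉0 with degree p
  ... | inj₁ p≋0              = contradiction p≋0 p≉0
  ... | inj₂ (zero  , dp)     = inj₁ (_ , HasDegree.top dp , degree-0 dp)
  ... | inj₂ (suc n , (_ , t)) = inj₂ (n , t)

  positive-∤-constant : ∀ {p a} → a ≉ 0# → Positive p → p D.∤ [ a ]
  positive-∤-constant {p} {a} a≉0 (n , pₙ≉0) (q , qp≋a) with degree p | degree q
  ... | inj₁ p≋0 | _ = pₙ≉0 (at p≋0 (suc n))
  ... | inj₂ _ | inj₁ q≋0 = []-nonzero a≉0 (≋-trans (≋-sym qp≋a) (mul-congʳ p q≋0))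
  ... | inj₂ (m , dp) | inj₂ (k , dq)
    with ℕ.m+n≡0⇒n≡0 k (degree-unique qp≋a (degree-* dq dp) (degree-[] a≉0))
  ... | ≡.refl = pₙ≉0 (HasDegree.bounded dp (suc n) (s≤s z≤n))

  positive-∤1 : ∀ {p} → Positive p → p D.∤ S.1#
  positive-∤1 = positive-∤-constant 1≉0

  positive-scale⁻¹ : ∀ {a p q} → ([ a ] S.* p) ≋ q → Positive q → Positive p
  positive-scale⁻¹ {a} {p} ap≋q (n , qₙ≉0) = n , λ pₙ≈0 → qₙ≉0
    (trans (sym (at ap≋q (suc n)))
      (trans (coefficient-[]* a p (suc n)) (trans (*-congˡ pₙ≈0) (zeroʳ a))))

  irreducible-[]-prime : ∀ {π p q} → IsIrreducible π → [ π ] D.∣ p S.* q →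
                         [ π ] D.∤ p → [ π ] D.∤ q → ⊥
  irreducible-[]-prime {π} {p} {q} irr =
    gauss (λ x y π∣xy → irreducible-prime x y irr π∣xy) p q

  -- The irreducible factors of c are removed one by one, each of them
  -- either from g or from all the quotients.
  clear-denominator : ∀ {c g} L → c ≉ 0# → All (λ f → g D.∣ [ c ] S.* f) L →
    ¬ ¬ (∃₂ λ κ h → ([ κ ] S.* h) ≋ g × All (h D.∣_) L)
  clear-denominator {c} L = go (◁-wellFounded c)
    where
    go : ∀ {c g} → Acc _◁_ c → c ≉ 0# → All (λ f → g D.∣ [ c ] S.* f) L →
         ¬ ¬ (∃₂ λ κ h → ([ κ ] S.* h) ≋ g × All (h D.∣_) L)
    go {c} {g} (acc rec) c≉0 g∣cL k = ¬¬-excluded-middle {A = c ∣ 1#} λ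
      { (yes c∣1) → k (1# , g , mul-identityˡ g , All.map (D.∣-unit-* ([]-∣1 c∣1)) g∣cL)
      ; (no c∤1) → irreducible-factor c≉0 c∤1 λ (π , irr , c′ , c′π≈c) →
          let open IsIrreducible irr
              π≉0 = []-nonzero a≉0
              c′≉0 = *-nonzero⁻ˡ c′π≈c c≉0
              rec-c′ = rec (c≉0 , π , a∤1 , trans (*-comm π c′) c′π≈c)
              [c′π]≋[c] = ≋-trans ([]-* c′ π) (∷-cong c′π≈c ≋-refl)
              divide = λ {g g′ q f} → D.Domain.divide-common-factor poly-≈0? poly-nonzero
                {[ π ]} {[ c ]} {[ c′ ]} {g} {g′} {q} {f} π≉0 [c′π]≋[c]
          in ¬¬-excluded-middle {A = [ π ] D.∣ g} λ
          { (yes (g′ , g′π≋g)) → go rec-c′ c′≉0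
              (All.map (λ {f} (q , qg≋cf) → q , divide {g} {g′} {q} {f} g′π≋g qg≋cf) g∣cL)
              λ (κ , h , κh≋g′ , h∣L) → k (π * κ , h , 
                ≋-trans (mul-congʳ h (≋-sym ([]-* π κ))) (≋-trans (mul-assoc [ π ] [ κ ] h)
                  (≋-trans (mul-congˡ [ π ] κh≋g′) (≋-trans (mul-comm [ π ] g′) g′π≋g))) , h∣L)
          -- Here `π` divides `q g ≋ c f` but not `g`, so by Gauss's lemma it cannot fail to divide
          -- `q`. Cancelling `π` on both sides replaces `c` by `c′` for every `f`.
          ; (no π∤g) → ¬¬-all
              (All.map (λ {f} (q , qg≋cf) ¬g∣c′f → irreducible-[]-prime irr
                  (f S.* [ c′ ] ,
                    ≋-trans (mul-assoc f [ c′ ] [ π ]) (≋-trans (mul-congˡ f [c′π]≋[c])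
                      (≋-trans (mul-comm f [ c ]) (≋-sym qg≋cf))))
                  (λ (q′ , q′π≋q) → ¬g∣c′f (q′ , ≋-trans (mul-comm q′ g)
                    (divide {q} {q′} {g} {f} q′π≋q (≋-trans (mul-comm g q) qg≋cf))))
                  π∤g) g∣cL)
              λ g∣c′L → go rec-c′ c′≉0 g∣c′L k
          }
      }

  -- Pseudo-division and Bézout relations

  X^_ : ℕ → Poly
  X^ zero    = S.1#
  X^ (suc k) = 0# ∷ X^ k

  coefficient-X^-* : ∀ k p i → coefficient ((X^ k) S.* p) (k ℕ.+ i) ≈ coefficient p i
  coefficient-X^-* zero    p i = at (mul-identityˡ p) i
  coefficient-X^-* (suc k) p i = trans
    (at (mul-0∷ˡ (X^ k) p) (suc (k ℕ.+ i))) (coefficient-X^-* k p i)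

  -- A greatest common divisor over the fraction field of `R` with denominators cleared: `g` is a
  -- combination of `a` and `b` over `R`, but divides them only after multiplication by a nonzero
  -- constant `c`.
  record Bezout (a b : Poly) : Set (r ⊔ ℓ) where
    field
      g u v       : Poly
      c           : Carrier
      c≉0         : c ≉ 0#
      combination : u S.* a S.+ v S.* b S.≈ g
      g∣ca        : g D.∣ [ c ] S.* a
      g∣cb        : g D.∣ [ c ] S.* b

  bezout-swap : ∀ {a b} → Bezout a b → Bezout b a
  bezout-swap {a} {b} bz = record
    { u = v ; v = u ; c≉0 = c≉0 ; g∣ca = g∣cb ; g∣cb = g∣ca
    ; combination = ≋-trans (add-comm (v S.* b) (u S.* a)) combination }
    where open Bezout bz

  -- The leading coefficient of `b` need not be invertible, so `a` is multiplied by it before the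
  -- multiple `t b` that cancels the top term is subtracted.
  pseudo-division : ∀ k n a b → Bounded a (suc (k ℕ.+ n)) → Bounded b (suc n) →
    ∃₂ λ a′ t → Bounded a′ (k ℕ.+ n) × a′ S.+ t S.* b S.≈ [ coefficient b n ] S.* a
  pseudo-division k n a b ba bb = a′ , t , bounded , ≋-trans
    (add-assoc (lb S.* a) (S.- (t S.* b)) (t S.* b))
    (≋-trans (add-cong ≋-refl (add-inverseˡ (t S.* b))) (add-identityʳ (lb S.* a)))
    where
    lb = [ coefficient b n ]
    t  = [ coefficient a (k ℕ.+ n) ] S.* (X^ k)
    a′ = lb S.* a S.- t S.* b

    coefficient-a′ : ∀ j → coefficient a′ (k ℕ.+ j) ≈
      coefficient b n * coefficient a (k ℕ.+ j) - coefficient a (k ℕ.+ n) * coefficient b j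
    coefficient-a′ j = trans (coefficient-add (lb S.* a) _ (k ℕ.+ j)) (+-cong
      (coefficient-[]* (coefficient b n) a (k ℕ.+ j))
      (trans (coefficient-neg (t S.* b) (k ℕ.+ j)) (-‿cong
        (trans (at (mul-assoc [ coefficient a (k ℕ.+ n) ] (X^ k) b) (k ℕ.+ j))
          (trans (coefficient-[]* _ ((X^ k) S.* b) (k ℕ.+ j))
            (*-congˡ (coefficient-X^-* k b j)))))))

    bounded : Bounded a′ (k ℕ.+ n)
    bounded i k+n≤i with ℕ.m≤n⇒∃[o]m+o≡n (ℕ.≤-trans (ℕ.m≤m+n k n) k+n≤i)
    ... | j , ≡.refl with ℕ.m≤n⇒m<n∨m≡n (ℕ.+-cancelˡ-≤ k n j k+n≤i)
    ...   | inj₂ ≡.refl = trans (coefficient-a′ n) (trans (+-congʳ (*-comm _ _)) (-‿inverseʳ _))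
    ...   | inj₁ n<j    = trans (coefficient-a′ j) (trans
      (+-cong (trans (*-congˡ (ba (k ℕ.+ j) k+n<k+j)) (zeroʳ _))
              (-‿cong (trans (*-congˡ (bb j n<j)) (zeroʳ _))))
      (-‿inverseʳ 0#))
      where
      k+n<k+j = ℕ.≤-trans (ℕ.≤-reflexive (≡.sym (ℕ.+-suc k n))) (ℕ.+-monoʳ-≤ k n<j)

  bezout-reduce : ∀ {a a′ b l t} → l ≉ 0# → a′ S.+ t S.* b S.≈ [ l ] S.* a →
                  Bezout a′ b → Bezout a b
  bezout-reduce {a} {a′} {b} {l} {t} l≉0 a′+tb≋la bz = record
    { u           = u S.* [ l ]
    ; v           = v S.- u S.* t
    ; c           = l * c
    ; c≉0         = *-nonzero l≉0 c≉0
    ; combination = D.reduce-bezout {a} {a′} {b} {g} {[ l ]} {t} {u} {v} combination a′+tb≋la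
    ; g∣ca        = D.∣ʳ-respʳ-≈ (mul-congʳ a ([]-* l c))
        (D.reduce-divisor {a} {a′} {b} {g} {[ c ]} {[ l ]} {t} a′+tb≋la g∣ca g∣cb)
    ; g∣cb        = D.∣ʳ-respʳ-≈
        (≋-trans (≋-sym (mul-assoc [ l ] [ c ] b)) (mul-congʳ b ([]-* l c)))
        (D.x∣ʳy⇒x∣ʳzy [ l ] g∣cb)
    }
    where open Bezout bz

  bezout-zero : ∀ {a b} → a ≋ [] → Bezout a b
  bezout-zero {a} {b} a≋0 = record
    { g = b ; u = S.0# ; v = S.1# ; c = 1# ; c≉0 = 1≉0
    ; combination = mul-identityˡ b
    ; g∣ca = D.∣ʳ-respʳ-≈ (≋-sym (≋-trans (mul-identityˡ a) a≋0)) (D._∣0 b)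
    ; g∣cb = S.1# , ≋-refl
    }

  bezout : ∀ a b → Bezout a b
  bezout a b = go _ _ _ ℕ.≤-refl a b (bounded-length a) (bounded-length b)
    where
    diff : ∀ {m n} → m ℕ.≤ n → ∃[ k ] k ℕ.+ m ≡ n
    diff {m} {n} m≤n = n ℕ.∸ m , ℕ.m∸n+n≡m m≤n

    -- The Euclidean algorithm, with `t` as recursion measure for the sum of the two bounds. A
    -- vanishing top coefficient just lowers a bound; otherwise the polynomial with the larger bound
    -- is reduced.
    go : ∀ t m n → m ℕ.+ n ℕ.≤ t → ∀ a b → Bounded a m → Bounded b n → Bezout a b
    go t       zero    n       _       a b ba bb = bezout-zero (bounded-0 {a} ba)
    go t       (suc m) zero    _       a b ba bb = bezout-swap (bezout-zero (bounded-0 {b} bb))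
    go (suc t) (suc m) (suc n) (s≤s h) a b ba bb
      with ≈0? (coefficient a m) | ≈0? (coefficient b n) | ℕ.≤-total n m
    ... | yes aₘ≈0 | _ | _ = go t m (suc n) h a b (bounded-pred {a} ba aₘ≈0) bb
    ... | no _ | yes bₙ≈0 | _ = go t (suc m) n (ℕ.≤-trans (ℕ.≤-reflexive (≡.sym (ℕ.+-suc m n))) h)
                                  a b ba (bounded-pred {b} bb bₙ≈0)
    ... | no _ | no bₙ≉0 | inj₁ n≤m with diff n≤m
    ...   | k , ≡.refl = let a′ , t′ , ba′ , e = pseudo-division k n a b ba bb in
      bezout-reduce {a} {a′} {b} {t = t′} bₙ≉0 e (go t m (suc n) h a′ b ba′ bb)
    go (suc t) (suc m) (suc n) (s≤s h) a b ba bb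
        | no aₘ≉0 | no _ | inj₂ m≤n with diff m≤n
    ...   | k , ≡.refl = let b′ , t′ , bb′ , e = pseudo-division k m b a bb ba in
      bezout-swap (bezout-reduce {b} {b′} {a} {t = t′} aₘ≉0 e (bezout-swap
        (go t (suc m) n (ℕ.≤-trans (ℕ.≤-reflexive (≡.sym (ℕ.+-suc m n))) h) a b′ ba bb′)))

  -- A constant `h` falls under Gauss's lemma. Otherwise let `g` be the combination from
  -- `bezout h a`. If `g` is a constant `κ`, then `h` divides `κ b`, and clearing `κ` leaves a
  -- divisor of `b` of positive degree that differs from `h` by a unit. If `g` has positive degree,
  -- clearing `c` yields a common divisor of `h` and `a` of positive degree, again associate to `h`.
  irreducible-poly-prime : ∀ {h} a b → D.IsIrreducible h → h D.∣ a S.* b →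
                           h D.∤ a → h D.∤ b → ⊥
  irreducible-poly-prime {h} a b irr h∣ab h∤a h∤b
    with constant-or-positive (D.IsIrreducible.a≉0 irr)
  ... | inj₁ (π , π≉0 , h≋π) = irreducible-[]-prime irr-π
      (D.∣ʳ-respˡ-≈ h≋π h∣ab) (h∤a ∘ D.∣ʳ-respˡ-≈ (≋-sym h≋π)) (h∤b ∘ D.∣ʳ-respˡ-≈ (≋-sym h≋π))
    where
    open D.IsIrreducible irr
    irr-π : IsIrreducible π
    irr-π = record
      { a≉0 = π≉0
      ; a∤1 = λ π∣1 → a∤1 (D.∣ʳ-respˡ-≈ (≋-sym h≋π) ([]-∣1 π∣1))
      ; split = λ x y xy≈π x∤1 y∤1 → split [ x ] [ y ]
          (≋-trans ([]-* x y) (≋-trans (∷-cong xy≈π ≋-refl) (≋-sym h≋π)))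
          (x∤1 ∘ []-∣1⁻¹) (y∤1 ∘ []-∣1⁻¹)
      }
  ... | inj₂ h-positive with bezout h a
  ...   | bz with constant-or-positive {Bezout.g bz} g≉0
    where
    open Bezout bz
    g≉0 : g S.≉ S.0#
    g≉0 g≋0 = poly-nonzero ([]-nonzero c≉0) (D.IsIrreducible.a≉0 irr)
      (D.0∣x⇒x≈0 (D.∣ʳ-respˡ-≈ g≋0 g∣ca))
  ... | inj₁ (κ , κ≉0 , g≋κ) = clear-denominator (b ∷ []) κ≉0 (h∣κb ∷ [])
      λ { (κ′ , h′ , κ′h′≋h , h′∣b ∷ []) →
        D.IsIrreducible.split irr [ κ′ ] h′ κ′h′≋h
          (λ κ′∣1 → h∤b (D.∣ʳ-trans (D.∣-unit-* κ′∣1 (D.∣ʳ-respʳ-≈ (≋-sym κ′h′≋h) D.∣ʳ-refl)) h′∣b))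
          (positive-∤1 (positive-scale⁻¹ {κ′} {h′} κ′h′≋h h-positive)) }
    where
    open Bezout bz
    h∣κb : h D.∣ [ κ ] S.* b
    h∣κb = D.∣ʳ-respʳ-≈ (≋-trans (≋-sym (mul-distribʳ b (u S.* h) (v S.* a)))
        (mul-congʳ b (≋-trans combination g≋κ)))
      (D.∣-+ (D.∣-*ʳ b (D.x∣ʳyx h u))
        (D.∣ʳ-respʳ-≈ (≋-sym (mul-assoc v a b)) (D.x∣ʳy⇒x∣ʳzy v h∣ab)))
  ... | inj₂ g-positive = clear-denominator (h ∷ a ∷ []) c≉0 (g∣ca ∷ g∣cb ∷ [])
      λ { (κ , g′ , κg′≋g , (w , wg′≋h) ∷ g′∣a ∷ []) →
        D.IsIrreducible.split irr w g′ wg′≋h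
          (λ w∣1 → h∤a (D.∣ʳ-trans (D.∣-unit-* w∣1 (D.∣ʳ-respʳ-≈ (≋-sym wg′≋h) D.∣ʳ-refl)) g′∣a))
          (positive-∤1 (positive-scale⁻¹ {κ} {g′} κg′≋g g-positive)) }
    where open Bezout bz

  poly-isFactorial : D.IsFactorial
  poly-isFactorial = record
    { ≈0?               = poly-≈0?
    ; 1≉0               = []-nonzero 1≉0
    ; *-nonzero         = poly-nonzero
    ; ◁-wellFounded     = ◁-poly-wellFounded
    ; irreducible-prime = irreducible-poly-prime
    }

  -- Ideals and elimination of the variable

  record IsIdeal (I : Poly → Set ℓ) : Set (r ⊔ ℓ) where
    field
      resp-≋   : ∀ {p q} → p ≋ q → I p → I q
      0∈       : I S.0#
      +-closed : ∀ {p q} → I p → I q → I (p S.+ q)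
      *-closed : ∀ p {q} → I q → I (p S.* q)

  -- Membership of g in the ideal generated by L, by its elimination rule.
  _∈⟨_⟩ : Poly → List Poly → Set (r ⊔ Level.suc ℓ)
  g ∈⟨ L ⟩ = ∀ {I} → IsIdeal I → All I L → I g

  bezout-list : ∀ L → ∃₂ λ g κ → g ∈⟨ L ⟩ × κ ≉ 0# × All (λ f → g D.∣ [ κ ] S.* f) L
  bezout-list []      = S.0# , 1# , (λ ideal _ → IsIdeal.0∈ ideal) , 1≉0 , []
  bezout-list (f ∷ L) with bezout-list L
  ... | g , κ , g∈⟨L⟩ , κ≉0 , g∣κL = B.g , B.c * κ , g∈ , *-nonzero B.c≉0 κ≉0 ,
    D.∣ʳ-trans B.g∣ca (scale-∣ κ f) ∷
    All.map (λ {f} g∣κf → D.∣ʳ-trans B.g∣cb (D.∣ʳ-respʳ-≈ ([]-*-assoc B.c κ f)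
      (x∣y⇒zx∣zy [ B.c ] g∣κf))) g∣κL
    where
    open import Algebra.Properties.CommutativeSemigroup.Divisibility S.*-commutativeSemigroup
      using (x∣y⇒zx∣zy)
    module B = Bezout (bezout f g)
    g∈ : B.g ∈⟨ f ∷ L ⟩
    g∈ ideal (f∈I ∷ L∈I) = resp-≋ B.combination
      (+-closed (*-closed B.u f∈I) (*-closed B.v (g∈⟨L⟩ ideal L∈I)))
      where open IsIdeal ideal
    []-*-assoc : ∀ a b p → [ a ] S.* ([ b ] S.* p) S.≈ [ a * b ] S.* p
    []-*-assoc a b p = ≋-trans (≋-sym (mul-assoc [ a ] [ b ] p)) (mul-congʳ p ([]-* a b))
    scale-∣ : ∀ κ p → [ B.c ] S.* p D.∣ [ B.c * κ ] S.* p
    scale-∣ κ p = [ κ ] , ≋-trans ([]-*-assoc κ B.c p)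
      (mul-congʳ p {[ κ * B.c ]} (∷-cong (*-comm κ B.c) ≋-refl))

  -- The combination `g` from `bezout-list` is nonzero because it divides `κ f` for a nonzero `f`.
  -- Were its degree positive, clearing `κ` would turn it into a common divisor of `L` of positive
  -- degree; so `g` is a constant.
  eliminate : ∀ L → Any (S._≉ S.0#) L → ¬ (∃[ h ] Positive h × All (h D.∣_) L) →
              ∃[ δ ] δ ≉ 0# × [ δ ] ∈⟨ L ⟩
  eliminate L L≉0 coprime with bezout-list L
  ... | g , κ , g∈⟨L⟩ , κ≉0 , g∣κL with constant-or-positive {g} g≉0
    where
    g≉0 : g S.≉ S.0#
    g≉0 g≋0 = let g∣κf , f≉0 = All.lookupAny g∣κL L≉0 in
      poly-nonzero {[ κ ]} ([]-nonzero κ≉0) f≉0 (D.0∣x⇒x≈0 (D.∣ʳ-respˡ-≈ g≋0 g∣κf))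
  ... | inj₁ (δ , δ≉0 , g≋δ) = δ , δ≉0 , λ ideal L∈I → IsIdeal.resp-≋ ideal g≋δ (g∈⟨L⟩ ideal L∈I)
  ... | inj₂ g-positive = contradiction
    (λ (κ , h , κh≋g , h∣L) → coprime (h , positive-scale⁻¹ {κ} {h} κh≋g g-positive , h∣L))
    (clear-denominator L κ≉0 g∣κL)

open import Relation.Binary.PropositionalEquality
  using (_≢_; refl; sym; trans; cong; cong₂; subst; subst₂; module ≡-Reasoning)

-- Coprime splittings of natural numbers

module Naturals where
  open import Data.Nat.Base using (_*_; _<_; NonZero)
  open Coprimality using (Coprime; coprime-divisor; coprime-/gcd; gcd≡1⇒coprime)
  open import Data.Nat.Divisibility
  open import Data.Nat.DivMod using (_/_; m/n*n≡m)
  open import Data.Nat.GCD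
  open import Data.Nat.LCM using (lcm; gcd*lcm)
  open import Data.Nat.ListAction using (product)
  open import Data.Nat.Properties
  open import Data.Nat.Tactic.RingSolver using (solve-∀)

  gcd-cong : ∀ {m n k} → (∀ {d} → d ∣ k → d ∣ m → d ∣ n) →
             (∀ {d} → d ∣ k → d ∣ n → d ∣ m) →
             gcd m k ≡ gcd n k
  gcd-cong {m} {n} {k} m⇒n n⇒m = ∣-antisym
    (gcd-greatest (m⇒n (gcd[m,n]∣n m k) (gcd[m,n]∣m m k)) (gcd[m,n]∣n m k))
    (gcd-greatest (n⇒m (gcd[m,n]∣n n k) (gcd[m,n]∣m n k)) (gcd[m,n]∣n n k))

  ∣-coprime : ∀ {d m n} → d ∣ n → Coprime m n → Coprime m d
  ∣-coprime d∣n m⊥n (k∣m , k∣d) = m⊥n (k∣m , ∣-trans k∣d d∣n)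

  gcd-coprime-* : ∀ {a m n} → Coprime a n → gcd (a * m) n ≡ gcd m n
  gcd-coprime-* {a} a⊥n = gcd-cong
    (λ d∣n → coprime-divisor (Coprimality.sym (∣-coprime d∣n a⊥n)))
    (λ _ → ∣n⇒∣m*n a)

  -- The two factors are coprime divisors of `g`, so their product divides `g`. Conversely,
  -- distributing the product over both gcds writes it as an iterated gcd of multiples of `g`.
  gcd-*-gcd : ∀ {g m n} → Coprime m n → g ∣ m * n → gcd g m * gcd g n ≡ g
  gcd-*-gcd {g} {m} {n} m⊥n g∣mn = ∣-antisym
    (coprime-*-∣ gcd-coprime (gcd[m,n]∣m g m) (gcd[m,n]∣m g n))
    (subst (g ∣_) (trans (sym (c*gcd[m,n]≡gcd[cm,cn] (gcd g n) g m)) (*-comm (gcd g n) (gcd g m)))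
      (gcd-greatest (∣n⇒∣m*n (gcd g n) ∣-refl)
        (subst (g ∣_) (trans (sym (c*gcd[m,n]≡gcd[cm,cn] m g n)) (*-comm m (gcd g n)))
          (gcd-greatest (∣n⇒∣m*n m ∣-refl) g∣mn))))
    where
    gcd-coprime : Coprime (gcd g m) (gcd g n)
    gcd-coprime (d∣gm , d∣gn) = m⊥n (∣-trans d∣gm (gcd[m,n]∣n g m) , ∣-trans d∣gn (gcd[m,n]∣n g n))
    coprime-*-∣ : ∀ {a b k} → Coprime a b → a ∣ k → b ∣ k → a * b ∣ k
    coprime-*-∣ {a} {b} a⊥b (divides q refl) b∣qa =
      subst (_∣ q * a) (*-comm b a)
        (*-monoˡ-∣ a (coprime-divisor (Coprimality.sym a⊥b) (subst (b ∣_) (*-comm q a) b∣qa)))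

  -- `N₁` takes the primes of `M` that divide `e` and `N₂` the others; the last clause says so for
  -- `N₁` without mentioning primes. The construction moves `gcd e M` from `M` to `N₁` until it
  -- becomes 1.
  coprime-splitting : ∀ e M → M ≢ 0 → ∃₂ λ N₁ N₂ → N₁ * N₂ ≡ M × Coprime e N₂ ×
                      (∀ {f} → Coprime e f → Coprime f N₁)
  coprime-splitting e M = go (<-wellFounded M)
    where
    go : ∀ {M} → Acc _<_ M → M ≢ 0 → ∃₂ λ N₁ N₂ → N₁ * N₂ ≡ M × Coprime e N₂ ×
         (∀ {f} → Coprime e f → Coprime f N₁)
    go {M} (acc rec) M≢0 with gcd e M ≟ 1 | gcd[m,n]∣n e M
    ... | yes g≡1 | _ = 1 , M , +-identityʳ M , gcd≡1⇒coprime g≡1 , λ _ (_ , d∣1) → ∣1⇒≡1 d∣1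
    ... | no  g≢1 | divides M′ M≡M′g =
      let N₁ , N₂ , N₁N₂≡M′ , e⊥N₂ , ⊥N₁ = go (rec M′<M) M′≢0 in
      g * N₁ , N₂ ,
      trans (*-assoc g N₁ N₂) (trans (cong (g *_) N₁N₂≡M′) (trans (*-comm g M′) (sym M≡M′g))) ,
      e⊥N₂ , λ e⊥f (d∣f , d∣gN₁) → ⊥N₁ e⊥f (d∣f , coprime-divisor
        (λ (k∣d , k∣g) → e⊥f (∣-trans k∣g (gcd[m,n]∣m e M) , ∣-trans k∣d d∣f)) d∣gN₁)
      where
      g = gcd e M
      M′≢0 : M′ ≢ 0
      M′≢0 refl = M≢0 M≡M′g
      g≢0 : g ≢ 0
      g≢0 g≡0 = M≢0 (gcd[m,n]≡0⇒n≡0 e g≡0)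
      M′<M : M′ < M
      M′<M = subst (M′ <_) (sym M≡M′g) (m<m*n M′ g {{ℕ.≢-nonZero M′≢0}}
        (≤∧≢⇒< (n≢0⇒n>0 g≢0) (g≢1 ∘ sym)))

  -- With `g` the gcd, `N₁` collects the primes of `a / g`, those at which `a` has the higher
  -- valuation. As `a / g` is coprime to `N₂` and `b / g` to `N₁`, the parts `gcd a N₂` and
  -- `gcd b N₁` agree with those of `g`, and these multiply to `g`.
  gcd-lcm-splitting : ∀ {a b M} → a ≢ 0 → M ≢ 0 → a ∣ M → b ∣ M →
    ∃₂ λ N₁ N₂ → N₁ * N₂ ≡ M × Coprime N₁ N₂ ×
      gcd b N₁ * gcd a N₂ ≡ gcd a b × gcd a N₁ * gcd b N₂ ≡ lcm a b
  gcd-lcm-splitting {a} {b} {M} a≢0 M≢0 a∣M b∣M = go (coprime-splitting (a / g) M M≢0)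
    where
    g = gcd a b
    instance
      g-nonZero : NonZero g
      g-nonZero = ℕ.≢-nonZero (a≢0 ∘ gcd[m,n]≡0⇒m≡0)
    a/g*g≡a = m/n*n≡m {a} {g} (gcd[m,n]∣m a b)
    b/g*g≡b = m/n*n≡m {b} {g} (gcd[m,n]∣n a b)
    go : (∃₂ λ N₁ N₂ → N₁ * N₂ ≡ M × Coprime (a / g) N₂ ×
         (∀ {f} → Coprime (a / g) f → Coprime f N₁)) →
      ∃₂ λ N₁ N₂ → N₁ * N₂ ≡ M × Coprime N₁ N₂ ×
      gcd b N₁ * gcd a N₂ ≡ gcd a b × gcd a N₁ * gcd b N₂ ≡ lcm a b
    go (N₁ , N₂ , N₁N₂≡M , a/g⊥N₂ , ⊥N₁) = N₁ , N₂ , N₁N₂≡M , N₁⊥N₂ , gcd-part ,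
      -- Multiplied by the gcd identity, the claim for the lcm contains all four parts, which
      -- together give `a * b`.
      *-cancelˡ-≡ _ _ g (begin
        g * (gcd a N₁ * gcd b N₂)
          ≡⟨ cong (_* (gcd a N₁ * gcd b N₂)) gcd-part ⟨
        gcd b N₁ * gcd a N₂ * (gcd a N₁ * gcd b N₂)
          ≡⟨ exchange (gcd b N₁) (gcd a N₂) (gcd a N₁) (gcd b N₂) ⟩
        (gcd a N₁ * gcd a N₂) * (gcd b N₁ * gcd b N₂)
          ≡⟨ cong₂ _*_ (full a∣M) (full b∣M) ⟩
        a * b
          ≡⟨ gcd*lcm a b ⟨
        g * lcm a b ∎)
      where
      open ≡-Reasoning
      N₁⊥N₂ : Coprime N₁ N₂
      N₁⊥N₂ = Coprimality.sym (⊥N₁ a/g⊥N₂)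
      full : ∀ {d} → d ∣ M → gcd d N₁ * gcd d N₂ ≡ d
      full d∣M = gcd-*-gcd N₁⊥N₂ (subst (_ ∣_) (sym N₁N₂≡M) d∣M)
      gcd-part : gcd b N₁ * gcd a N₂ ≡ g
      gcd-part = trans (cong₂ _*_
        (trans (cong (λ b → gcd b N₁) (sym b/g*g≡b)) (gcd-coprime-* (⊥N₁ (coprime-/gcd a b))))
        (trans (cong (λ a → gcd a N₂) (sym a/g*g≡a)) (gcd-coprime-* a/g⊥N₂)))
        (full (∣-trans (gcd[m,n]∣m a b) a∣M))
      exchange : ∀ m n o p → m * n * (o * p) ≡ (o * n) * (m * p)
      exchange = solve-∀

  prime-divisor : ∀ {h} → h ≢ 1 → ∃[ p ] Prime p × p ∣ h
  prime-divisor {zero}  _   = 2 , prime[2] , (2 ∣0)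
  prime-divisor {suc h} h≢1 = go factors isFactorisation factorsPrime
    where
    open PrimeFactorisation (factorise (suc h))
    go : ∀ ps → suc h ≡ product ps → All Prime ps → ∃[ p ] Prime p × p ∣ suc h
    go []       h≡1   _               = contradiction h≡1 h≢1
    go (p ∷ ps) h≡pps (p-prime ∷ _) = p , p-prime , subst (p ∣_) (sym h≡pps) (m∣m*n (product ps))

  -- Let `d = h T`. A prime `p` dividing `h` divides `d`, hence `B * B`, hence `B`. As `T` also
  -- divides `B`, the product `p T` divides both `d` and `B * B` and therefore `T`, which is absurd.
  -- So `h = 1`.
  determined-by-gcd : ∀ {d B T} → B ≢ 0 → T ∣ B → gcd d (B * B) ≡ T →
                      (∀ {p} → Prime p → p ∣ d → p ∣ B * B) → d ≡ T
  determined-by-gcd {d} {B} {T} B≢0 T∣B gcd≡T common-prime∣ with T∣d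
    where
    T∣d : T ∣ d
    T∣d = subst (_∣ d) gcd≡T (gcd[m,n]∣m d (B * B))
  ... | divides h d≡hT with h ≟ 1
  ...   | yes refl = trans d≡hT (+-identityʳ T)
  ...   | no  h≢1  = contradiction (prime-divisor h≢1) λ (p , p-prime , p∣h) →
    let p∣d = subst (p ∣_) (sym d≡hT) (∣m⇒∣m*n T p∣h)
        p∣B = ∣B p-prime (common-prime∣ p-prime p∣d)
        pT∣T = subst (p * T ∣_) gcd≡T (gcd-greatest
          (subst (p * T ∣_) (sym d≡hT) (*-monoˡ-∣ T p∣h))
          (*-pres-∣ p∣B T∣B))
        p∣1 = *-cancelʳ-∣ T {{T-nonZero}} (subst (p * T ∣_) (sym (*-identityˡ T)) pT∣T)
    in ¬prime[1] (subst Prime (∣1⇒≡1 p∣1) p-prime)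
    where
    T-nonZero : NonZero T
    T-nonZero = ℕ.≢-nonZero λ { refl → B≢0 (0∣⇒≡0 T∣B) }
    ∣B : ∀ {p} → Prime p → p ∣ B * B → p ∣ B
    ∣B p-prime p∣BB with euclidsLemma B B p-prime p∣BB
    ... | inj₁ p∣B = p∣B
    ... | inj₂ p∣B = p∣B

open Naturals

-- The ring ℤ[x₁,…,xᵣ] and its evaluations

module _ {a ℓ ℓ′ : Level} (R : CommutativeRing a ℓ) where
  open CommutativeRing R renaming (refl to ≈-refl; sym to ≈-sym; trans to ≈-trans)

  -- The record `_≋_` and the pointwise equality it wraps are equivalent but different relations.
  -- Ring laws and factoriality pass from one to the other with carrier and operations fixed.
  module Transport (_≈′_ : Carrier → Carrier → Set ℓ′)
    (to : ∀ {x y} → x ≈ y → x ≈′ y) (from : ∀ {x y} → x ≈′ y → x ≈ y) where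

    transport-isCommutativeRing : IsCommutativeRing _≈′_ _+_ _*_ -_ 0# 1#
    transport-isCommutativeRing = record
      { isRing = record
        { +-isAbelianGroup = record
          { isGroup = record
            { isMonoid = record
              { isSemigroup = record
                { isMagma = record
                  { isEquivalence = record
                    { refl  = to ≈-refl
                    ; sym   = to ∘ ≈-sym ∘ from
                    ; trans = λ p q → to (≈-trans (from p) (from q))
                    }
                  ; ∙-cong = λ p q → to (+-cong (from p) (from q))
                  }
                ; assoc = λ x y z → to (+-assoc x y z)
                }
              ; identity = to ∘ +-identityˡ , to ∘ +-identityʳ
              }
            ; inverse = to ∘ -‿inverseˡ , to ∘ -‿inverseʳ
            ; ⁻¹-cong = to ∘ -‿cong ∘ from
            }
          ; comm = λ x y → to (+-comm x y)
          }
        ; *-cong = λ p q → to (*-cong (from p) (from q))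
        ; *-assoc = λ x y z → to (*-assoc x y z)
        ; *-identity = to ∘ *-identityˡ , to ∘ *-identityʳ
        ; distrib = (λ x y z → to (distribˡ x y z)) , (λ x y z → to (distribʳ x y z))
        }
      ; *-comm = λ x y → to (*-comm x y)
      }

    transport : CommutativeRing a ℓ′
    transport = record { isCommutativeRing = transport-isCommutativeRing }

    private
      module D  = Divisibility R
      module D′ = Divisibility transport

    ∣-to : ∀ {x y} → x D.∣ y → x D′.∣ y
    ∣-to (q , qx≈y) = q , to qx≈y

    ∣-from : ∀ {x y} → x D′.∣ y → x D.∣ y
    ∣-from (q , qx≈y) = q , from qx≈y

    transport-isFactorial : D.IsFactorial → D′.IsFactorial
    transport-isFactorial isFactorial = record
      { ≈0?               = λ x → map′ to from (≈0? x)
      ; 1≉0               = 1≉0 ∘ from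
      ; *-nonzero         = λ a≉0 b≉0 → *-nonzero (a≉0 ∘ to) (b≉0 ∘ to) ∘ from
      ; ◁-wellFounded     = λ x → wellFounded (◁-wellFounded x)
      ; irreducible-prime = λ x y irr a∣xy a∤x a∤y → irreducible-prime x y
          (irreducible irr) (∣-from a∣xy) (a∤x ∘ ∣-to) (a∤y ∘ ∣-to)
      }
      where
      open D.IsFactorial isFactorial
      wellFounded : ∀ {x} → Acc D._◁_ x → Acc D′._◁_ x
      wellFounded (acc rec) = acc λ (x≉0 , w , w∤1 , wy≈x) →
        wellFounded (rec (x≉0 ∘ to , w , w∤1 ∘ ∣-to , from wy≈x))
      irreducible : ∀ {x} → D′.IsIrreducible x → D.IsIrreducible x
      irreducible irr = record
        { a≉0   = a≉0 ∘ to
        ; a∤1   = a∤1 ∘ ∣-to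
        ; split = λ x y xy≈a x∤1 y∤1 → split x y (to xy≈a) (x∤1 ∘ ∣-from) (y∤1 ∘ ∣-from)
        }
        where open D′.IsIrreducible irr

-- From _≋_ back to the equality of Defs.
module Unwrap {a ℓ} (R : CommutativeRing a ℓ) =
  Transport (PolynomialRing.polynomials R)
    (RawRing._≈_ (Univariate.rawRing (CommutativeRing.rawRing R)))
    PolynomialRing.at PolynomialRing.coefficientwise

isCommutativeRing : ∀ r → let open RawRing (ℤ[x] r) in
                    IsCommutativeRing _≈_ _+_ _*_ -_ 0# 1#

ring : ℕ → CommutativeRing 0ℓ 0ℓ
ring r = record { isCommutativeRing = isCommutativeRing r }

isCommutativeRing zero    = ℤ.+-*-isCommutativeRing
isCommutativeRing (suc r) = Unwrap.transport-isCommutativeRing (ring r)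

-- Everything is read off from absolute values: they drop along `_◁_`, and the absolute value of an
-- irreducible integer is prime.
ℤ-isFactorial : Divisibility.IsFactorial (ring 0)
ℤ-isFactorial = record
  { ≈0?               = ℤ._≟ 0ℤ
  ; 1≉0               = λ ()
  ; *-nonzero         = λ {a} a≢0 b≢0 ab≡0 → Sum.[ a≢0 , b≢0 ] (ℤ.i*j≡0⇒i≡0∨j≡0 a ab≡0)
  ; ◁-wellFounded     = Subrelation.wellFounded ◁⇒< (On.wellFounded ℤ.∣_∣ <-wellFounded)
  ; irreducible-prime = prime
  }
  where
  open import Data.Integer.Base using (∣_∣)
  open Divisibility (ring 0)

  unit : ∀ {x} → ∣ x ∣ ≡ 1 → x ∣ 1ℤ
  unit ∣x∣≡1 with Signed.divides q 1≡qx ← Signed.∣ᵤ⇒∣ (ℕ.∣-reflexive ∣x∣≡1) = q , sym 1≡qx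

  unit⁻¹ : ∀ {x} → x ∣ 1ℤ → ∣ x ∣ ≡ 1
  unit⁻¹ (q , qx≡1) = ℕ.∣1⇒≡1 (Signed.∣⇒∣ᵤ (Signed.divides q (sym qx≡1)))

  ◁⇒< : ∀ {b a} → b ◁ a → ∣ b ∣ ℕ.< ∣ a ∣
  ◁⇒< {b} {a} (a≢0 , x , x∤1 , xb≡a) = begin-strict
    ∣ b ∣               <⟨ ℕ.m<m*n ∣ b ∣ ∣ x ∣ 1<∣x∣ ⟩
    ∣ b ∣ ℕ.* ∣ x ∣     ≡⟨ ℕ.*-comm ∣ b ∣ ∣ x ∣ ⟩
    ∣ x ∣ ℕ.* ∣ b ∣     ≡⟨ ℤ.abs-* x b ⟨
    ∣ x ℤ.* b ∣         ≡⟨ cong ∣_∣ xb≡a ⟩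
    ∣ a ∣ ∎
    where
    open ℕ.≤-Reasoning
    1<∣x∣ : 1 ℕ.< ∣ x ∣
    1<∣x∣ = ℕ.≤∧≢⇒< (ℕ.n≢0⇒n>0 (λ ∣x∣≡0 → a≢0 (trans (sym xb≡a)
      (cong (ℤ._* b) (ℤ.∣i∣≡0⇒i≡0 {x} ∣x∣≡0))))) (x∤1 ∘ unit {x} ∘ sym)
    instance
      b≢0 : ℕ.NonZero ∣ b ∣
      b≢0 = ℕ.≢-nonZero λ ∣b∣≡0 → a≢0 (trans (sym xb≡a)
        (trans (cong (x ℤ.*_) (ℤ.∣i∣≡0⇒i≡0 ∣b∣≡0)) (ℤ.*-zeroʳ x)))

  prime : ∀ {a} x y → IsIrreducible a → a ∣ x ℤ.* y → a ∤ x → a ∤ y → ⊥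
  prime {a} x y irr (q , qa≡xy) a∤x a∤y = Sum.[ a∤x ∘ fromℕ x , a∤y ∘ fromℕ y ]
    (euclidsLemma ∣ x ∣ ∣ y ∣ ∣a∣-prime (subst (∣ a ∣ ℕ.∣_) (ℤ.abs-* x y)
      (Signed.∣⇒∣ᵤ (Signed.divides q (sym qa≡xy)))))
    where
    open IsIrreducible irr
    fromℕ : ∀ z → ∣ a ∣ ℕ.∣ ∣ z ∣ → a ∣ z
    fromℕ z ∣a∣∣∣z∣ with Signed.divides q z≡qa ← Signed.∣ᵤ⇒∣ {a} {z} ∣a∣∣∣z∣ = q , sym z≡qa
    ∣a∣-irreducible : Irreducible ∣ a ∣
    ∣a∣-irreducible {d} d∣∣a∣ with d ℕ.≟ 1 | d ℕ.≟ ∣ a ∣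
    ... | yes d≡1 | _         = inj₁ d≡1
    ... | no  _   | yes d≡∣a∣ = inj₂ d≡∣a∣
    ... | no  d≢1 | no d≢∣a∣  with Signed.divides q a≡qd ← Signed.∣ᵤ⇒∣ {+ d} {a} d∣∣a∣ =
      ⊥-elim (split q (+ d) (sym a≡qd)
        (λ q∣1 → d≢∣a∣ (sym (trans (cong ∣_∣ a≡qd) (trans (ℤ.abs-* q (+ d))
          (trans (cong (ℕ._* d) (unit⁻¹ q∣1)) (ℕ.*-identityˡ d))))))
        (d≢1 ∘ unit⁻¹))
    ∣a∣-prime : Prime ∣ a ∣
    ∣a∣-prime = irreducible⇒prime {{nontrivial}} ∣a∣-irreducible
      where
      nontrivial : ℕ.NonTrivial ∣ a ∣
      nontrivial = ℕ.n>1⇒nonTrivial (ℕ.≤∧≢⇒< (ℕ.n≢0⇒n>0 (a≉0 ∘ ℤ.∣i∣≡0⇒i≡0))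
        (a∤1 ∘ unit ∘ sym))

isFactorial : ∀ r → Divisibility.IsFactorial (ring r)
isFactorial zero    = ℤ-isFactorial
isFactorial (suc r) = Unwrap.transport-isFactorial (ring r)
  (FactorialPolynomials.poly-isFactorial (ring r) (isFactorial r))

record IsRingHomℤ (R : CommutativeRing 0ℓ 0ℓ) (φ : CommutativeRing.Carrier R → ℤ) : Set where
  open CommutativeRing R using (_≈_; _+_; _*_; 0#; +-identityˡ)
  field
    φ-cong : ∀ {x y} → x ≈ y → φ x ≡ φ y
    φ-+    : ∀ x y → φ (x + y) ≡ φ x ℤ.+ φ y
    φ-*    : ∀ x y → φ (x * y) ≡ φ x ℤ.* φ y

  φ-0 : φ 0# ≡ 0ℤ
  φ-0 = +-identityʳ-unique (φ 0#) (φ 0#)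
    (trans (sym (φ-+ 0# 0#)) (φ-cong (+-identityˡ 0#)))
    where open import Algebra.Properties.Ring ℤ.+-*-ring using (+-identityʳ-unique)

module Horner {R : CommutativeRing 0ℓ 0ℓ} {φ : CommutativeRing.Carrier R → ℤ}
  (hom : IsRingHomℤ R φ) (x : ℤ) where
  open CommutativeRing R using (Carrier; _≈_; _+_; _*_; 0#)
  open IsRingHomℤ hom
  open PolynomialRing R using (_≋_; at; coefficientwise; add; mul; scale)
  open ≡-Reasoning

  -- With the evaluation in the remaining variables as `φ`, this is by definition `evaluate` for one
  -- variable more.
  horner : List Carrier → ℤ
  horner = List.foldr (λ c y → φ c ℤ.+ x ℤ.* y) 0ℤ

  horner-≋[] : ∀ {p} → p ≋ [] → horner p ≡ 0ℤ
  horner-≋[] {[]}    _    = refl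
  horner-≋[] {c ∷ p} p≋[] = begin
    φ c ℤ.+ x ℤ.* horner p ≡⟨ cong₂ (λ y z → y ℤ.+ x ℤ.* z)
      (trans (φ-cong (at p≋[] 0)) φ-0) (horner-≋[] {p} (coefficientwise (at p≋[] ∘ suc))) ⟩
    0ℤ ℤ.+ x ℤ.* 0ℤ        ≡⟨ trans (ℤ.+-identityˡ _) (ℤ.*-zeroʳ x) ⟩
    0ℤ                     ∎

  horner-cong : ∀ {p q} → p ≋ q → horner p ≡ horner q
  horner-cong {[]}    {q}     p≋q =
    sym (horner-≋[] {q} (coefficientwise λ i → CommutativeRing.sym R (at p≋q i)))
  horner-cong {c ∷ p} {[]}    p≋q = horner-≋[] {c ∷ p} p≋q
  horner-cong {c ∷ p} {d ∷ q} p≋q = cong₂ (λ y z → y ℤ.+ x ℤ.* z)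
    (φ-cong (at p≋q 0)) (horner-cong {p} {q} (coefficientwise (at p≋q ∘ suc)))

  horner-add : ∀ p q → horner (add p q) ≡ horner p ℤ.+ horner q
  horner-add []      q       = sym (ℤ.+-identityˡ _)
  horner-add (c ∷ p) []      = sym (ℤ.+-identityʳ _)
  horner-add (c ∷ p) (d ∷ q) = trans
    (cong₂ (λ y z → y ℤ.+ x ℤ.* z) (φ-+ c d) (horner-add p q))
    (identity (φ c) (φ d) x (horner p) (horner q))
    where
    identity : ∀ c d x p q → c ℤ.+ d ℤ.+ x ℤ.* (p ℤ.+ q) ≡ (c ℤ.+ x ℤ.* p) ℤ.+ (d ℤ.+ x ℤ.* q)
    identity = ℤ-Solver.solve-∀

  horner-scale : ∀ a p → horner (scale a p) ≡ φ a ℤ.* horner p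
  horner-scale a []      = sym (ℤ.*-zeroʳ (φ a))
  horner-scale a (c ∷ p) = trans
    (cong₂ (λ y z → y ℤ.+ x ℤ.* z) (φ-* a c) (horner-scale a p))
    (identity (φ a) (φ c) x (horner p))
    where
    identity : ∀ a c x p → a ℤ.* c ℤ.+ x ℤ.* (a ℤ.* p) ≡ a ℤ.* (c ℤ.+ x ℤ.* p)
    identity = ℤ-Solver.solve-∀

  horner-mul : ∀ p q → horner (mul p q) ≡ horner p ℤ.* horner q
  horner-mul []      q = refl
  horner-mul (c ∷ p) q = begin
    horner (add (scale c q) (0# ∷ mul p q))
      ≡⟨ horner-add (scale c q) (0# ∷ mul p q) ⟩
    horner (scale c q) ℤ.+ (φ 0# ℤ.+ x ℤ.* horner (mul p q))
      ≡⟨ cong₂ ℤ._+_ (horner-scale c q) (cong₂ (λ y z → y ℤ.+ x ℤ.* z) φ-0 (horner-mul p q)) ⟩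
    φ c ℤ.* horner q ℤ.+ (0ℤ ℤ.+ x ℤ.* (horner p ℤ.* horner q))
      ≡⟨ identity (φ c) x (horner p) (horner q) ⟩
    (φ c ℤ.+ x ℤ.* horner p) ℤ.* horner q ∎
    where
    identity : ∀ c x p q → c ℤ.* q ℤ.+ (0ℤ ℤ.+ x ℤ.* (p ℤ.* q)) ≡ (c ℤ.+ x ℤ.* p) ℤ.* q
    identity = ℤ-Solver.solve-∀

open Multivariate ℤ.+-*-rawRing using (evaluate) renaming (coefficient to coefficientℤ)

evaluate-isRingHom : ∀ r n → IsRingHomℤ (ring r) (λ f → evaluate r f n)
evaluate-isRingHom zero    []      = record
  { φ-cong = λ { refl → refl } ; φ-+ = λ _ _ → refl ; φ-* = λ _ _ → refl }
evaluate-isRingHom (suc r) (x ∷ n) = record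
  { φ-cong = λ {p} {q} p≈q → horner-cong {p} {q} (PolynomialRing.coefficientwise p≈q)
  ; φ-+ = horner-add ; φ-* = horner-mul }
  where open Horner (evaluate-isRingHom r n) x

open Signed using (_∣_; divides; _∣?_; ∣ᵤ⇒∣; ∣⇒∣ᵤ; ∣m∣n⇒∣m+n; ∣m∣n⇒∣m-n;
  ∣n⇒∣m*n; ∣m⇒∣m*n; ∣m+n∣m⇒∣n; ∣-trans; ∣-refl)
open import Data.Integer.GCD using (gcd)
open import Data.Integer.LCM using (lcm)

-- Avoiding roots modulo primes

value : List ℤ → ℤ → ℤ
value v x = List.foldr (λ c y → c ℤ.+ x ℤ.* y) 0ℤ v

value-mod : ∀ {m} x y v → m ∣ x ℤ.- y → m ∣ value v x ℤ.- value v y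
value-mod     x y []      m∣x-y = divides 0ℤ refl
value-mod {m} x y (c ∷ v) m∣x-y = subst (m ∣_) (identity c x y (value v x) (value v y))
  (∣m∣n⇒∣m+n (∣n⇒∣m*n x (value-mod x y v m∣x-y)) (∣m⇒∣m*n (value v y) m∣x-y))
  where
  identity : ∀ c x y p q → x ℤ.* (p ℤ.- q) ℤ.+ (x ℤ.- y) ℤ.* q ≡ (c ℤ.+ x ℤ.* p) ℤ.- (c ℤ.+ y ℤ.* q)
  identity = ℤ-Solver.solve-∀

∣-congruent : ∀ {m} x y → m ∣ x ℤ.- y → m ∣ x → m ∣ y
∣-congruent {m} x y m∣x-y m∣x = subst (m ∣_) (identity x y) (∣m∣n⇒∣m-n m∣x m∣x-y)
  where
  identity : ∀ x y → x ℤ.- (x ℤ.- y) ≡ y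
  identity = ℤ-Solver.solve-∀

-- The quotient of c ∷ v by X - t, which does not depend on c.
quotient : List ℤ → ℤ → List ℤ
quotient []      t = []
quotient (d ∷ v) t = value (d ∷ v) t ∷ quotient v t

length-quotient : ∀ v t → length (quotient v t) ≡ length v
length-quotient []      t = refl
length-quotient (d ∷ v) t = cong suc (length-quotient v t)

value-quotient : ∀ c v t x →
  value (c ∷ v) x ≡ value (c ∷ v) t ℤ.+ (x ℤ.- t) ℤ.* value (quotient v t) x
value-quotient c []      t x = identity c t x
  where
  identity : ∀ c t x → c ℤ.+ x ℤ.* 0ℤ ≡ c ℤ.+ t ℤ.* 0ℤ ℤ.+ (x ℤ.- t) ℤ.* 0ℤ
  identity = ℤ-Solver.solve-∀
value-quotient c (d ∷ v) t x = trans
  (cong (λ y → c ℤ.+ x ℤ.* y) (value-quotient d v t x))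
  (identity c t x (value (d ∷ v) t) (value (quotient v t) x))
  where
  identity : ∀ c t x p q → c ℤ.+ x ℤ.* (p ℤ.+ (x ℤ.- t) ℤ.* q) ≡
             c ℤ.+ t ℤ.* p ℤ.+ (x ℤ.- t) ℤ.* (p ℤ.+ x ℤ.* q)
  identity = ℤ-Solver.solve-∀

-- Both 0 and the primes: the generators of the prime ideals of ℤ.
Euclidean : ℕ → Set
Euclidean p = ∀ x y → + p ∣ x ℤ.* y → (+ p ∣ x) ⊎ (+ p ∣ y)

0-euclidean : Euclidean 0
0-euclidean x y 0∣xy with ℤ.i*j≡0⇒i≡0∨j≡0 x (Signed.0∣⇒≡0 0∣xy)
... | inj₁ refl = inj₁ ∣-refl
... | inj₂ refl = inj₂ ∣-refl

prime-euclidean : ∀ {p} → Prime p → Euclidean p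
prime-euclidean {p} p-prime x y p∣xy with euclidsLemma ℤ.∣ x ∣ ℤ.∣ y ∣ p-prime
  (subst (p ℕ.∣_) (ℤ.abs-* x y) (∣⇒∣ᵤ p∣xy))
... | inj₁ p∣x = inj₁ (∣ᵤ⇒∣ p∣x)
... | inj₂ p∣y = inj₂ (∣ᵤ⇒∣ p∣y)

module _ {p : ℕ} (euclidean : Euclidean p) where

  -- The entries of the quotient are successive Horner values at `t`, and each coefficient is one
  -- Horner value minus `t` times the next.
  ∣-quotient⁻¹ : ∀ c v t → + p ∣ value (c ∷ v) t → All (+ p ∣_) (quotient v t) →
                 All (+ p ∣_) (c ∷ v)
  ∣-quotient⁻¹ c []      t p∣cv[t] [] = subst (+ p ∣_) (identity c t) p∣cv[t] ∷ []
    where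
    identity : ∀ c t → c ℤ.+ t ℤ.* 0ℤ ≡ c
    identity = ℤ-Solver.solve-∀
  ∣-quotient⁻¹ c (d ∷ v) t p∣cv[t] (p∣v[t] ∷ p∣q) =
    subst (+ p ∣_) (identity c t (value (d ∷ v) t)) (∣m∣n⇒∣m-n p∣cv[t] (∣n⇒∣m*n t p∣v[t])) ∷
    ∣-quotient⁻¹ d v t p∣v[t] p∣q
    where
    identity : ∀ c t y → c ℤ.+ t ℤ.* y ℤ.- t ℤ.* y ≡ c
    identity = ℤ-Solver.solve-∀

  -- Lagrange's bound on the number of roots. After division by `X - t` the other points are roots
  -- of the quotient, since `p` is Euclidean and does not divide `s - t`; the quotient has one
  -- coefficient fewer. For `p = 0` this concerns roots in ℤ.
  few-roots : ∀ v ts → length v ℕ.≤ length ts → AllPairs (λ s t → ¬ + p ∣ t ℤ.- s) ts →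
              All (λ t → + p ∣ value v t) ts → All (+ p ∣_) v
  few-roots []      ts       _         _               _                   = []
  few-roots (c ∷ v) (t ∷ ts) (s≤s v≤ts) (t≉ts ∷ distinct) (p∣v[t] ∷ p∣v[ts]) =
    ∣-quotient⁻¹ c v t p∣v[t] (few-roots (quotient v t) ts
      (ℕ.≤-trans (ℕ.≤-reflexive (length-quotient v t)) v≤ts) distinct
      (All.zipWith (λ {s} (t≉s , p∣v[s]) → cancel s t≉s p∣v[s]) (t≉ts , p∣v[ts])))
    where
    cancel : ∀ s → ¬ + p ∣ s ℤ.- t → + p ∣ value (c ∷ v) s → + p ∣ value (quotient v t) s
    cancel s p∤s-t p∣v[s] with euclidean (s ℤ.- t) (value (quotient v t) s)
      (∣m+n∣m⇒∣n (subst (+ p ∣_) (value-quotient c v t s) p∣v[s]) p∣v[t])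
    ... | inj₁ p∣s-t = contradiction p∣s-t p∤s-t
    ... | inj₂ p∣q   = p∣q

  -- The candidates `a + M k`, one for each coefficient of `v`, are pairwise incongruent modulo `p`:
  -- their differences are `M` times an integer between 1 and `length v`. By `few-roots` they cannot
  -- all be roots.
  non-root : ∀ v M a → ¬ All (+ p ∣_) v → ¬ + p ∣ + M →
             (∀ j → 1 ℕ.≤ j → j ℕ.≤ length v → ¬ + p ∣ + j) →
             ∃[ x ] + M ∣ x ℤ.- a × ¬ + p ∣ value v x
  non-root v M a p∤v p∤M p∤j =
    let v≤points = ℕ.≤-reflexive (sym (List.length-applyUpTo point (length v)))
        k , _ , p∤v[k] = Any.applyUpTo⁻ point (All.¬All⇒Any¬ (λ t → + p ∣? value v t) points
          (p∤v ∘ few-roots v points v≤points distinct))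
    in point k , divides (+ k) (identity a (+ M) (+ k)) , p∤v[k]
    where
    point : ℕ → ℤ
    point k = a ℤ.+ + M ℤ.* + k
    points = List.applyUpTo point (length v)

    identity : ∀ a m k → a ℤ.+ m ℤ.* k ℤ.- a ≡ k ℤ.* m
    identity = ℤ-Solver.solve-∀

    difference : ∀ a m i j → a ℤ.+ m ℤ.* j ℤ.- (a ℤ.+ m ℤ.* i) ≡ m ℤ.* (j ℤ.- i)
    difference = ℤ-Solver.solve-∀

    distinct : AllPairs (λ s t → ¬ + p ∣ t ℤ.- s) points
    distinct = AllPairs.applyUpTo⁺₁ point (length v) λ {i} {j} i<j j<n p∣ →
      Sum.[ p∤M , p∤j (j ℕ.∸ i) (ℕ.m<n⇒0<n∸m i<j) (ℕ.≤-trans (ℕ.m∸n≤m j i) (ℕ.<⇒≤ j<n))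
            ∘ subst (+ p ∣_) (trans (ℤ.m-n≡m⊖n j i) (ℤ.⊖-≥ (ℕ.<⇒≤ i<j))) ]
      (euclidean (+ M) (+ j ℤ.- + i) (subst (+ p ∣_) (difference a (+ M) (+ i) (+ j)) p∣))

-- The point is moved, successively, away from the roots of some v ∈ vs
-- modulo each prime that does not divide M, and then away from those of e.
module Sieve (vs : List (List ℤ)) (e : List ℤ) where

  NonRoot : ℕ → ℤ → Set
  NonRoot p x = ¬ All (λ v → + p ∣ value v x) vs

  Sifted : ℕ → List ℕ → ℤ → Set
  Sifted N ps a = ∃[ x ] + N ∣ x ℤ.- a × value e x ≢ 0ℤ × All (λ p → p ℕ.∣ N ⊎ NonRoot p x) ps

  nonRoot-mod : ∀ {p} x y → + p ∣ x ℤ.- y → NonRoot p y → NonRoot p x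
  nonRoot-mod x y p∣x-y p∤vs[y] p∣vs[x] = p∤vs[y]
    (All.map (λ {v} → ∣-congruent (value v x) (value v y) (value-mod x y v p∣x-y)) p∣vs[x])

  prime∣prime : ∀ {p q} → Prime p → Prime q → q ℕ.∣ p → q ≡ p
  prime∣prime p-prime q-prime q∣p with prime⇒irreducible p-prime q∣p
  ... | inj₁ refl = contradiction q-prime ¬prime[1]
  ... | inj₂ q≡p  = q≡p

  -- Passing to the modulus `N * p` freezes the residue at `p`, so later moves preserve `NonRoot p`.
  -- A prime excused for dividing `N * p` either divides `N` or is `p`, and at `p` the point is
  -- already good.
  sift-prime : ∀ {N p ps a y} → Prime p → All Prime ps → + N ∣ y ℤ.- a → NonRoot p y →
               Sifted (N ℕ.* p) ps y → Sifted N (p ∷ ps) a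
  sift-prime {N} {p} {ps} {a} {y} p-prime ps-prime N∣y-a p∤vs[y] (x , Np∣x-y , e[x]≢0 , sifted) =
    x , subst (+ N ∣_) (telescope x y a) (∣m∣n⇒∣m+n (∣-trans (∣ᵤ⇒∣ (ℕ.m∣m*n p)) Np∣x-y) N∣y-a) ,
    e[x]≢0 , inj₂ p∤vs[x] ∷ All.zipWith keep (ps-prime , sifted)
    where
    telescope : ∀ x y a → (x ℤ.- y) ℤ.+ (y ℤ.- a) ≡ x ℤ.- a
    telescope = ℤ-Solver.solve-∀
    p∤vs[x] : NonRoot p x
    p∤vs[x] = nonRoot-mod x y (∣-trans (∣ᵤ⇒∣ (ℕ.n∣m*n N)) Np∣x-y) p∤vs[y]
    keep : ∀ {q} → Prime q × (q ℕ.∣ N ℕ.* p ⊎ NonRoot q x) → q ℕ.∣ N ⊎ NonRoot q x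
    keep (q-prime , inj₂ q∤vs[x]) = inj₂ q∤vs[x]
    keep (q-prime , inj₁ q∣Np) with euclidsLemma N p q-prime q∣Np
    ... | inj₁ q∣N = inj₁ q∣N
    ... | inj₂ q∣p with refl ← prime∣prime p-prime q-prime q∣p = inj₂ p∤vs[x]

  module _ {M : ℕ} (e≢0 : ¬ All (+ 0 ∣_) e)
    (nonzero : ∀ {p} → Prime p → ¬ p ℕ.∣ M → Any (λ v → ¬ All (+ p ∣_) v) vs)
    (small : All (λ v → ∀ j → 1 ℕ.≤ j → j ℕ.≤ length v → j ℕ.∣ M) vs) where

    non-root-prime : ∀ {p N} a → Prime p → M ℕ.∣ N → ¬ p ℕ.∣ N →
                     ∃[ x ] + N ∣ x ℤ.- a × NonRoot p x
    non-root-prime {p} {N} a p-prime M∣N p∤N =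
      go small (nonzero p-prime λ p∣M → p∤N (ℕ.∣-trans p∣M M∣N))
      where
      go : ∀ {us} → All (λ v → ∀ j → 1 ℕ.≤ j → j ℕ.≤ length v → j ℕ.∣ M) us →
           Any (λ v → ¬ All (+ p ∣_) v) us →
           ∃[ x ] + N ∣ x ℤ.- a × ¬ All (λ v → + p ∣ value v x) us
      go (small-v ∷ _) (here {v} p∤v) = through
        (non-root (prime-euclidean p-prime) v N a p∤v (p∤N ∘ ∣⇒∣ᵤ)
          (λ j 1≤j j≤v p∣j → p∤N (ℕ.∣-trans (∣⇒∣ᵤ p∣j) (ℕ.∣-trans (small-v j 1≤j j≤v) M∣N))))
        where
        through : ∀ {us} → ∃[ x ] + N ∣ x ℤ.- a × ¬ (+ p ∣ value v x) →
                  ∃[ x ] + N ∣ x ℤ.- a × ¬ All (λ v → + p ∣ value v x) (v ∷ us)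
        through (x , N∣x-a , p∤v[x]) = x , N∣x-a , p∤v[x] ∘ All.head
      go (_ ∷ small-us) (there p∤us) = through (go small-us p∤us)
        where
        through : ∀ {v us} → ∃[ x ] + N ∣ x ℤ.- a × ¬ All (λ v → + p ∣ value v x) us →
                  ∃[ x ] + N ∣ x ℤ.- a × ¬ All (λ v → + p ∣ value v x) (v ∷ us)
        through (x , N∣x-a , p∤us[x]) = x , N∣x-a , p∤us[x] ∘ All.tail

    sieve : ∀ {ps} → All Prime ps → ∀ N → N ≢ 0 → M ℕ.∣ N → ∀ a → Sifted N ps a
    -- Divisibility by 0 means vanishing, so the case `p = 0` of `non-root` avoids the integer roots
    -- of `e`. The integers `j` start at 1, hence 0 divides none of them.
    sieve [] N N≢0 M∣N a = through (non-root 0-euclidean e N a e≢0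
      (N≢0 ∘ ℤ.+-injective ∘ Signed.0∣⇒≡0)
      (λ { (suc j) _ _ 0∣j → contradiction (Signed.0∣⇒≡0 0∣j) λ () }))
      where
      through : ∃[ x ] + N ∣ x ℤ.- a × ¬ (+ 0 ∣ value e x) → Sifted N [] a
      through (x , N∣x-a , e[x]≢0) =
        x , N∣x-a , (λ e[x]≡0 → e[x]≢0 (subst (+ 0 ∣_) (sym e[x]≡0) ∣-refl)) , []
    sieve {p ∷ ps} (p-prime ∷ ps-prime) N N≢0 M∣N a = by-cases (p ℕ.∣? N)
      where
      skip : p ℕ.∣ N → Sifted N ps a → Sifted N (p ∷ ps) a
      skip p∣N (x , N∣x-a , e[x]≢0 , sifted) = x , N∣x-a , e[x]≢0 , inj₁ p∣N ∷ sifted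
      sift : (∃[ y ] + N ∣ y ℤ.- a × NonRoot p y) → Sifted N (p ∷ ps) a
      sift (y , N∣y-a , p∤vs[y]) = sift-prime p-prime ps-prime N∣y-a p∤vs[y]
        (sieve ps-prime (N ℕ.* p)
          (λ Np≡0 → Sum.[ N≢0 , ℕ.≢-nonZero⁻¹ p {{prime⇒nonZero p-prime}} ]
            (ℕ.m*n≡0⇒m≡0∨n≡0 N Np≡0))
          (ℕ.∣-trans M∣N (ℕ.m∣m*n p)) y)
      by-cases : Dec (p ℕ.∣ N) → Sifted N (p ∷ ps) a
      by-cases (yes p∣N) = skip p∣N (sieve ps-prime N N≢0 M∣N a)
      by-cases (no p∤N)  = sift (non-root-prime a p-prime M∣N p∤N)


-- Points at which few primes divide all the values

NonConstant : ∀ r → ℤPolynomial r → Set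
NonConstant r f = ∃[ e ] coefficientℤ r f e ≢ 0ℤ × Vec.sum e ℕ.> 0

-- A common factor in ℤ is permitted, in accordance with coprimality over ℚ.
Coprime : ∀ r → List (ℤPolynomial r) → Set
Coprime r L = ¬ (∃[ d ] NonConstant r d × All (d D.∣_) L)
  where module D = Divisibility (ring r)

infix 4 _≡_[mod_]
_≡_[mod_] : ∀ {r} → Vec ℤ r → Vec ℤ r → ℕ → Set
n ≡ n′ [mod M ] = Pointwise (λ x y → + M ∣ x ℤ.- y) n n′

nonzero-coefficient : ∀ r {f} → NonZeroPolynomial r f →
                      ∃[ e ] coefficientℤ r f e ≢ 0ℤ
nonzero-coefficient zero    f≢0 = [] , f≢0
nonzero-coefficient (suc r) {f} f≉0 with FP.degree f
  where module FP = FactorialPolynomials (ring r) (isFactorial r)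
... | inj₁ f≋0          = contradiction (PolynomialRing.at f≋0) f≉0
... | inj₂ (n , df)
  with e , fₑ≢0 ← nonzero-coefficient r (FactorialPolynomials.HasDegree.top df) = n ∷ e , fₑ≢0

∣-factorial : ∀ {j m} → 1 ℕ.≤ j → j ℕ.≤ m → j ℕ.∣ m !
∣-factorial {suc j} _ j≤m = ℕ.∣-trans (ℕ.m∣m*n (j !)) (ℕ.m≤n⇒m!∣n! j≤m)

length≤concat : ∀ {a} {A : Set a} (xss : List (List A)) →
                All (λ xs → length xs ℕ.≤ length (concat xss)) xss
length≤concat []         = []
length≤concat (xs ∷ xss) = ℕ.≤-trans (ℕ.m≤m+n _ _) (ℕ.≤-reflexive (sym (List.length-++ xs))) ∷
  All.map (λ le → ℕ.≤-trans le (ℕ.≤-trans (ℕ.m≤n+m _ _) (ℕ.≤-reflexive (sym (List.length-++ xs)))))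
    (length≤concat xss)

-- The polynomial ε lets the induction keep finitely many polynomials
-- nonzero at the point.
record Approximation r (L : List (ℤPolynomial r)) (M : ℕ) (a : Vec ℤ r)
  (ε : ℤPolynomial r) : Set where
  field
    point         : Vec ℤ r
    point≡a       : point ≡ a [mod M ]
    ε≢0           : evaluate r ε point ≢ 0ℤ
    common-prime∣ : ∀ {p} → Prime p → All (λ f → + p ∣ evaluate r f point) L → p ℕ.∣ M

-- `β` is fixed before `M`, `a` and `ε`: it depends on `L` alone, so the modulus can be chosen
-- afterwards as a multiple of `β` and of given values of the gcd.
Approximable : ∀ r → List (ℤPolynomial r) → ℕ → Set
Approximable r L β = ∀ {M} → M ≢ 0 → β ℕ.∣ M → ∀ a ε →
  NonZeroPolynomial r ε → Approximation r L M a ε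

module Step (r : ℕ) (L : List (ℤPolynomial (suc r))) where
  open CommutativeRing (ring r) using (_≈_; _≉_; 0#; _*_)
  open FactorialPolynomials (ring r) (isFactorial r)
  open Divisibility.Factorial (ring r) (isFactorial r) using (*-nonzero)
  open PolynomialRing (ring r) using (coefficient; coefficientwise; at; _≋_)
  module U = Unwrap (ring r)
  module Dᵣ = Divisibility (ring r)

  all-coefficients : ∀ {P : ℤPolynomial r → Set} f → P 0# → All P f → ∀ i → P (coefficient f i)
  all-coefficients []      P0 []         i       = P0
  all-coefficients (c ∷ f) P0 (Pc ∷ Pf) zero    = Pc
  all-coefficients (c ∷ f) P0 (Pc ∷ Pf) (suc i) = all-coefficients f P0 Pf i

  any-coefficient : ∀ f i → coefficient f i ≉ 0# → Any (_≉ 0#) f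
  any-coefficient []      i       0≉0  = contradiction (CommutativeRing.refl (ring r)) 0≉0
  any-coefficient (c ∷ f) zero    c≉0  = here c≉0
  any-coefficient (c ∷ f) (suc i) fᵢ≉0 = there (any-coefficient f i fᵢ≉0)

  no-positive-divisor : Coprime (suc r) L → ¬ (∃[ h ] Positive h × All (h D.∣_) L)
  no-positive-divisor coprime (h , (n , hₙ≉0) , h∣L) with e , hₑ≢0 ← nonzero-coefficient r hₙ≉0 =
    coprime (h , (suc n ∷ e , hₑ≢0 , s≤s z≤n) , All.map U.∣-to h∣L)

  -- A common divisor of all coefficients, seen as a constant in `x₁`, divides every polynomial of
  -- `L`.
  coprime-coefficients : Coprime (suc r) L → Coprime r (concat L)
  coprime-coefficients coprime (d , (e , dₑ≢0 , e>0) , d∣L) = coprime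
    ([ d ] , (0 ∷ e , dₑ≢0 , e>0) , All.map (λ {f} d∣f → U.∣-to ([]-∣ f
      (all-coefficients f (d Dᵣ.∣0) d∣f))) (All.concat⁻ d∣L))

  nonzero-coefficients : Any (S._≉ S.0#) L → Any (_≉ 0#) (concat L)
  nonzero-coefficients = Any.concat⁺ ∘ Any.map nonzero
    where
    nonzero : ∀ {f} → f S.≉ S.0# → Any (_≉ 0#) f
    nonzero {f} f≉0 with degree f
    ... | inj₁ f≋0           = contradiction f≋0 f≉0
    ... | inj₂ (n , (_ , t)) = any-coefficient f n t

  module Evaluation (y : Vec ℤ r) where
    open IsRingHomℤ (evaluate-isRingHom r y)

    values : ℤPolynomial (suc r) → List ℤ
    values = List.map (λ c → evaluate r c y)

    evaluate-value : ∀ f x → evaluate (suc r) f (x ∷ y) ≡ value (values f) x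
    evaluate-value f x = sym (List.foldr-map (λ c z → c ℤ.+ x ℤ.* z) (λ c → evaluate r c y) 0ℤ f)

    ∣-values⁻¹ : ∀ {p} f → All (p ∣_) (values f) → ∀ i → p ∣ evaluate r (coefficient f i) y
    ∣-values⁻¹ {p} f p∣f =
      all-coefficients f (subst (p ∣_) (sym φ-0) (divides 0ℤ refl)) (All.map⁻ p∣f)

  -- Inserting this ideal into the membership of `[ δ ]` shows that `p` divides the value of `δ`
  -- once it divides the values of all polynomials in `L`.
  ∣-isIdeal : ∀ p n → IsIdeal (λ f → p ∣ evaluate (suc r) f n)
  ∣-isIdeal p n = record
    { resp-≋   = λ {f} {g} f≋g → subst (p ∣_) (φ-cong {f} {g} (at f≋g))
    ; 0∈       = subst (p ∣_) (sym φ-0) (divides 0ℤ refl)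
    ; +-closed = λ {f} {g} p∣f p∣g → subst (p ∣_) (sym (φ-+ f g)) (∣m∣n⇒∣m+n p∣f p∣g)
    ; *-closed = λ f {g} p∣g → subst (p ∣_) (sym (φ-* f g)) (∣n⇒∣m*n (evaluate (suc r) f n) p∣g)
    }
    where open IsRingHomℤ (evaluate-isRingHom (suc r) n)

  module _ {δ β} (δ≉0 : δ ≉ 0#) ([δ]∈⟨L⟩ : [ δ ] ∈⟨ L ⟩)
    (approximable : Approximable r (concat L) β) where

    -- At the point `y` obtained for the product of `δ` and the coefficient of `ε`, neither factor
    -- vanishes. The first leaves finitely many primes to the sieve; the second keeps `ε` a nonzero
    -- polynomial in `x₁` over `y`, whose roots the sieve avoids as well.
    extend : ∀ {M n a a₀ ε} → M ≢ 0 → β ℕ.* length (concat L) ! ℕ.∣ M → coefficient ε n ≉ 0# →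
             Approximation r (concat L) M a (δ * coefficient ε n) →
             Approximation (suc r) L M (a₀ ∷ a) ε
    extend {M} {n} {a} {a₀} {ε} M≢0 β∣M εₙ≉0 approximation =
      conclude (sieve e≢0 nonzero small factorsPrime M M≢0 ℕ.∣-refl a₀)
      where
      module A = Approximation approximation
      y = A.point
      open Evaluation y
      vs = List.map values L
      e  = values ε
      open Sieve vs e

      δ[y]εₙ[y]≢0 : evaluate r δ y ℤ.* evaluate r (coefficient ε n) y ≢ 0ℤ
      δ[y]εₙ[y]≢0 = A.ε≢0 ∘ trans (IsRingHomℤ.φ-* (evaluate-isRingHom r y) δ (coefficient ε n))

      δ[y]≢0 : evaluate r δ y ≢ 0ℤ
      δ[y]≢0 δ[y]≡0 = δ[y]εₙ[y]≢0 (cong (ℤ._* evaluate r (coefficient ε n) y) δ[y]≡0)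

      instance
        δ[y]-nonZero : ℕ.NonZero ℤ.∣ evaluate r δ y ∣
        δ[y]-nonZero = ℕ.≢-nonZero (δ[y]≢0 ∘ ℤ.∣i∣≡0⇒i≡0)

      open PrimeFactorisation (factorise ℤ.∣ evaluate r δ y ∣)

      e≢0 : ¬ All (+ 0 ∣_) e
      e≢0 0∣e = δ[y]εₙ[y]≢0 (trans (cong (evaluate r δ y ℤ.*_) (Signed.0∣⇒≡0 (∣-values⁻¹ ε 0∣e n)))
        (ℤ.*-zeroʳ (evaluate r δ y)))

      nonzero : ∀ {p} → Prime p → ¬ p ℕ.∣ M → Any (λ v → ¬ All (+ p ∣_) v) vs
      nonzero {p} p-prime p∤M = All.¬All⇒Any¬ (All.all? (+ p ∣?_)) vs λ p∣vs →
        p∤M (A.common-prime∣ p-prime (All.concat⁺ (All.map All.map⁻ (All.map⁻ p∣vs))))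

      small : All (λ v → ∀ j → 1 ℕ.≤ j → j ℕ.≤ length v → j ℕ.∣ M) vs
      -- The factorial in the modulus is that of the total number of coefficients in `L`, which
      -- bounds the length of each polynomial.
      small = All.map⁺ (All.map (λ {f} f≤m j 1≤j j≤f → ℕ.∣-trans
        (∣-factorial 1≤j (ℕ.≤-trans (ℕ.≤-trans j≤f (ℕ.≤-reflexive (List.length-map _ f))) f≤m))
        (ℕ.∣-trans (ℕ.n∣m*n β) β∣M)) (length≤concat L))

      common-prime∣ : ∀ {x p} → All (λ p → p ℕ.∣ M ⊎ NonRoot p x) factors →
        Prime p → All (λ f → + p ∣ evaluate (suc r) f (x ∷ y)) L → p ℕ.∣ M
      common-prime∣ {x} {p} factors∣M p-prime p∣L =
        Sum.[ (λ p∣M → p∣M)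
        , contradiction (All.map⁺ (All.map (λ {f} → subst (+ p ∣_) (evaluate-value f x)) p∣L)) ]
        (All.lookup factors∣M (factorisationHasAllPrimeFactors p-prime
          (subst (p ℕ.∣_) isFactorisation (∣⇒∣ᵤ p∣δ[y])) factorsPrime))
        where
        p∣δ[y] : + p ∣ evaluate r δ y
        p∣δ[y] = subst (+ p ∣_)
          (trans (cong (λ z → evaluate r δ y ℤ.+ z) (ℤ.*-zeroʳ x)) (ℤ.+-identityʳ _))
          ([δ]∈⟨L⟩ (∣-isIdeal (+ p) (x ∷ y)) p∣L)

      conclude : Sifted M factors a₀ → Approximation (suc r) L M (a₀ ∷ a) ε
      conclude (x , M∣x-a₀ , e[x]≢0 , factors∣M) = record
        { point         = x ∷ y
        ; point≡a       = M∣x-a₀ ∷ A.point≡a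
        ; ε≢0           = e[x]≢0 ∘ trans (sym (evaluate-value ε x))
        ; common-prime∣ = common-prime∣ {x} factors∣M
        }

    approximable-step : Approximable (suc r) L (β ℕ.* length (concat L) !)
    approximable-step {M} M≢0 β∣M (a₀ ∷ a) ε ε≉0 with degree ε
    ... | inj₁ ε≋0           = contradiction (at ε≋0) ε≉0
    ... | inj₂ (n , (_ , εₙ≉0)) = extend M≢0 β∣M εₙ≉0
      (approximable M≢0 (ℕ.∣-trans (ℕ.m∣m*n _) β∣M) a (δ * coefficient ε n) (*-nonzero δ≉0 εₙ≉0))

approximate : ∀ r L → Any (NonZeroPolynomial r) L →
              Coprime r L → ∃[ β ] β ≢ 0 × Approximable r L β
-- Without variables `L` contains a nonzero integer `f`; a prime dividing all entries divides `f`,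
-- and `f` divides `M`.
approximate zero    L L≢0 coprime = ℤ.∣ f ∣ , f≢0 ∘ ℤ.∣i∣≡0⇒i≡0 , λ M≢0 f∣M → λ { [] ε ε≢0 → record
  { point = [] ; point≡a = [] ; ε≢0 = ε≢0
  ; common-prime∣ = λ p-prime p∣L → ℕ.∣-trans (∣⇒∣ᵤ (proj₁ (All.lookupAny p∣L L≢0))) f∣M } }
  where
  f = Any.lookup L≢0
  f≢0 = Any.lookup-result L≢0
approximate (suc r) L L≉0 coprime
  with FactorialPolynomials.eliminate (ring r) (isFactorial r) L nonzero
         (Step.no-positive-divisor r L coprime)
     | approximate r (concat L) (Step.nonzero-coefficients r L nonzero)
         (Step.coprime-coefficients r L coprime)
  where nonzero = Any.map (λ f≉0 → f≉0 ∘ PolynomialRing.at) L≉0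
... | δ , δ≉0 , [δ]∈⟨L⟩ | β , β≢0 , approximable = β ℕ.* length (concat L) ! ,
  (λ β!≡0 → Sum.[ β≢0 , ℕ.≢-nonZero⁻¹ _ {{length (concat L) ℕ.!≢0}} ] (ℕ.m*n≡0⇒m≡0∨n≡0 β β!≡0)) ,
  Step.approximable-step r L δ≉0 [δ]∈⟨L⟩ approximable

-- From ℤ[x] to ℚ[x]

module ℚ[] = Multivariate ℚ.+-*-rawRing

fromℤ-+ : ∀ x y → fromℤ (x ℤ.+ y) ≡ fromℤ x ℚ.+ fromℤ y
fromℤ-+ x y = ℚ.toℚᵘ-injective (ℚᵘ.≃-trans (ℚᵘ.*≡* (identity x y))
  (ℚᵘ.≃-sym (ℚ.toℚᵘ-homo-+ (fromℤ x) (fromℤ y))))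
  where
  identity : ∀ x y → (x ℤ.+ y) ℤ.* 1ℤ ≡ (x ℤ.* 1ℤ ℤ.+ y ℤ.* 1ℤ) ℤ.* 1ℤ
  identity = ℤ-Solver.solve-∀

fromℤ-* : ∀ x y → fromℤ (x ℤ.* y) ≡ fromℤ x ℚ.* fromℤ y
fromℤ-* x y = ℚ.toℚᵘ-injective (ℚᵘ.≃-sym (ℚ.toℚᵘ-homo-* (fromℤ x) (fromℤ y)))

-- Sums and products are preserved up to `_≡_`. Then `List.map φ` commutes with the list operations
-- on the nose, and the induction over the variables calls on no ring laws of `S`.
record IsStrictHom (R S : RawRing 0ℓ 0ℓ) (φ : RawRing.Carrier R → RawRing.Carrier S) : Set where
  private
    module R = RawRing R
    module S = RawRing S
  field
    φ-cong : ∀ {x y} → x R.≈ y → φ x S.≈ φ y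
    φ-0    : φ R.0# ≡ S.0#
    φ-+    : ∀ x y → φ (x R.+ y) ≡ φ x S.+ φ y
    φ-*    : ∀ x y → φ (x R.* y) ≡ φ x S.* φ y

module _ {R S : RawRing 0ℓ 0ℓ} {φ : RawRing.Carrier R → RawRing.Carrier S}
  (hom : IsStrictHom R S φ) where
  open IsStrictHom hom
  private
    module R = RawRing R
    module S = RawRing S
    module R[x] = Univariate R
    module S[x] = Univariate S

  coefficient-map : ∀ p i → S[x].coefficient (List.map φ p) i ≡ φ (R[x].coefficient p i)
  coefficient-map []      i       = sym φ-0
  coefficient-map (c ∷ p) zero    = refl
  coefficient-map (c ∷ p) (suc i) = coefficient-map p i

  map-add : ∀ p q → List.map φ (R[x].add p q) ≡ S[x].add (List.map φ p) (List.map φ q)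
  map-add []      q       = refl
  map-add (c ∷ p) []      = refl
  map-add (c ∷ p) (d ∷ q) = cong₂ _∷_ (φ-+ c d) (map-add p q)

  map-scale : ∀ c q → List.map φ (List.map (c R.*_) q) ≡ List.map (φ c S.*_) (List.map φ q)
  map-scale c []      = refl
  map-scale c (d ∷ q) = cong₂ _∷_ (φ-* c d) (map-scale c q)

  map-mul : ∀ p q → List.map φ (R[x].mul p q) ≡ S[x].mul (List.map φ p) (List.map φ q)
  map-mul []      q = refl
  map-mul (c ∷ p) q = trans (map-add (List.map (c R.*_) q) (R.0# ∷ R[x].mul p q))
    (cong₂ S[x].add (map-scale c q) (cong₂ _∷_ φ-0 (map-mul p q)))

  map-isStrictHom : IsStrictHom R[x].rawRing S[x].rawRing (List.map φ)
  map-isStrictHom = record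
    { φ-cong = λ {p} {q} p≈q i → subst₂ S._≈_
        (sym (coefficient-map p i)) (sym (coefficient-map q i)) (φ-cong (p≈q i))
    ; φ-0 = refl ; φ-+ = map-add ; φ-* = map-mul }

toℚ[x]-isStrictHom : ∀ r → IsStrictHom (ℤ[x] r) (ℚ[x] r) (toℚ[x] r)
toℚ[x]-isStrictHom zero    = record
  { φ-cong = cong fromℤ ; φ-0 = refl ; φ-+ = fromℤ-+ ; φ-* = fromℤ-* }
toℚ[x]-isStrictHom (suc r) = map-isStrictHom (toℚ[x]-isStrictHom r)

coefficient-toℚ[x] : ∀ r f e → ℚ[].coefficient r (toℚ[x] r f) e ≡ fromℤ (coefficientℤ r f e)
coefficient-toℚ[x] zero    c []      = refl
coefficient-toℚ[x] (suc r) f (i ∷ e) = trans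
  (cong (λ c → ℚ[].coefficient r c e) (coefficient-map (toℚ[x]-isStrictHom r) f i))
  (coefficient-toℚ[x] r _ e)

coefficient-0 : ∀ r e → ℚ[].coefficient r (RawRing.0# (ℚ[x] r)) e ≡ 0ℚ
coefficient-0 zero    []      = refl
coefficient-0 (suc r) (i ∷ e) = coefficient-0 r e

degree-bound : ∀ r f → ∃[ B ] ∀ e → ℚ[].coefficient r f e ≢ 0ℚ → Vec.sum e ℕ.≤ B
degree-bound zero    c = 0 , λ { [] _ → z≤n }
degree-bound (suc r) f = go f
  where
  go : ∀ f → ∃[ B ] ∀ e → ℚ[].coefficient (suc r) f e ≢ 0ℚ → Vec.sum e ℕ.≤ B
  go []      = 0 , λ { (i ∷ e) 0≢0 → contradiction (coefficient-0 r e) 0≢0 }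
  go (c ∷ f) = bound (degree-bound r c) (go f)
    where
    bound : (∃[ B ] ∀ e → ℚ[].coefficient r c e ≢ 0ℚ → Vec.sum e ℕ.≤ B) →
            (∃[ B ] ∀ e → ℚ[].coefficient (suc r) f e ≢ 0ℚ → Vec.sum e ℕ.≤ B) →
            ∃[ B ] ∀ e → ℚ[].coefficient (suc r) (c ∷ f) e ≢ 0ℚ → Vec.sum e ℕ.≤ B
    bound (Bc , c≤Bc) (Bf , f≤Bf) = Bc ℕ.+ suc Bf , λ
      { (zero  ∷ e) cₑ≢0 → ℕ.≤-trans (c≤Bc e cₑ≢0) (ℕ.m≤m+n Bc _)
      ; (suc i ∷ e) fₑ≢0 → ℕ.≤-trans (s≤s (f≤Bf (i ∷ e) fₑ≢0)) (ℕ.m≤n+m (suc Bf) Bc) }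

-- Climb from `e`: either no nonzero coefficient has a larger exponent sum, or the search moves to
-- one that has. With the bound `B`, `k` limits the number of moves left. Maximality is not decided,
-- hence the double negation.
has-degree : ∀ r f e → ℚ[].coefficient r f e ≢ 0ℚ →
             ¬ ¬ (∃[ d ] Vec.sum e ℕ.≤ d × ℚ[].HasDegree r f d)
has-degree r f e fₑ≢0 with degree-bound r f
... | B , f≤B = go B e fₑ≢0 (ℕ.m≤n+m B (Vec.sum e))
  where
  go : ∀ k e → ℚ[].coefficient r f e ≢ 0ℚ → B ℕ.≤ Vec.sum e ℕ.+ k →
       ¬ ¬ (∃[ d ] Vec.sum e ℕ.≤ d × ℚ[].HasDegree r f d)
  go zero    e fₑ≢0 B≤ none = none (Vec.sum e , ℕ.≤-refl , (e , fₑ≢0 , refl) ,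
    λ e′ fₑ′≢0 → ℕ.≤-trans (f≤B e′ fₑ′≢0) (ℕ.≤-trans B≤ (ℕ.≤-reflexive (ℕ.+-identityʳ _))))
  go (suc k) e fₑ≢0 B≤ none = ¬¬-excluded-middle
    {A = ∃[ e′ ] ℚ[].coefficient r f e′ ≢ 0ℚ × Vec.sum e ℕ.< Vec.sum e′} λ
    { (yes (e′ , fₑ′≢0 , e<e′)) → go k e′ fₑ′≢0
        (ℕ.≤-trans B≤ (ℕ.≤-trans (ℕ.≤-reflexive (ℕ.+-suc _ k)) (ℕ.+-monoˡ-≤ k e<e′)))
        λ (d , e′≤d , deg) → none (d , ℕ.≤-trans (ℕ.<⇒≤ e<e′) e′≤d , deg)
    ; (no maximal) → none (Vec.sum e , ℕ.≤-refl , (e , fₑ≢0 , refl) ,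
        λ e′ fₑ′≢0 → ℕ.≮⇒≥ λ e<e′ → maximal (e′ , fₑ′≢0 , e<e′))
    }

-- A nonconstant common divisor in the integral ring stays a common divisor over ℚ, and one of its
-- nonzero coefficients forces its degree to be positive.
coprime-tabulate : ∀ r {s} (P : Vector (ℤPolynomial r) s) → CoprimePolynomials r P →
                   Coprime r (List.tabulate P)
coprime-tabulate r P coprime (D , (e , Dₑ≢0 , e>0) , D∣P) =
  has-degree r (toℚ[x] r D) e
    (λ eq → Dₑ≢0 (cong ℚ.ℚ.numerator (trans (sym (coefficient-toℚ[x] r D e)) eq)))
    λ (d , e≤d , deg) → coprime (toℚ[x] r D , (d , ℕ.≤-trans e>0 e≤d , deg) ,
      λ i → ∣-toℚ (All.tabulate⁻ D∣P i))
  where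
  open IsStrictHom (toℚ[x]-isStrictHom r)
  open Divisibility (ring r) renaming (_∣_ to _∣ᵣ_)
  open import Algebra.Definitions.RawSemiring (RawRing.rawSemiring (ℚ[x] r))
    using () renaming (_∣_ to _∣ℚ_)
  ∣-toℚ : ∀ {f} → D ∣ᵣ f → toℚ[x] r D ∣ℚ toℚ[x] r f
  ∣-toℚ {f} (q , qD≈f) = toℚ[x] r q , subst (λ g → RawRing._≈_ (ℚ[x] r) g (toℚ[x] r f))
    (φ-* q D) (φ-cong qD≈f)

-- Prescribing the gcd of the values

evaluate-mod : ∀ {M} r f {n n′} → n ≡ n′ [mod M ] → + M ∣ evaluate r f n ℤ.- evaluate r f n′
evaluate-mod zero    c [] = divides 0ℤ (ℤ.+-inverseʳ c)
evaluate-mod {M} (suc r) f {x ∷ n} {x′ ∷ n′} (x≡x′ ∷ n≡n′) = go f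
  where
  go : ∀ f → + M ∣ evaluate (suc r) f (x ∷ n) ℤ.- evaluate (suc r) f (x′ ∷ n′)
  go []      = divides 0ℤ refl
  go (c ∷ f) = subst (+ M ∣_)
    (identity (evaluate r c n) (evaluate r c n′) x x′
      (evaluate (suc r) f (x ∷ n)) (evaluate (suc r) f (x′ ∷ n′)))
    (∣m∣n⇒∣m+n (evaluate-mod r c n≡n′) (∣m∣n⇒∣m+n (∣n⇒∣m*n x (go f)) (∣m⇒∣m*n _ x≡x′)))
    where
    identity : ∀ c c′ x x′ p p′ → (c ℤ.- c′) ℤ.+ (x ℤ.* (p ℤ.- p′) ℤ.+ (x ℤ.- x′) ℤ.* p′) ≡
               (c ℤ.+ x ℤ.* p) ℤ.- (c′ ℤ.+ x′ ℤ.* p′)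
    identity = ℤ-Solver.solve-∀

idempotent : ∀ {M N} → Coprimality.Coprime M N → ∃[ u ] + M ∣ u × + N ∣ u ℤ.- 1ℤ
idempotent {M} {N} M⊥N with Coprimality.coprime-Bézout M⊥N
... | ℕ.Bézout.+- x y 1+yN≡xM = + (x ℕ.* M) , ∣ᵤ⇒∣ (ℕ.n∣m*n x) ,
  divides (+ y) (trans (cong (λ u → + u ℤ.- 1ℤ) (sym 1+yN≡xM)) (ℤ.pos-* y N))
... | ℕ.Bézout.-+ x y 1+xM≡yN = ℤ.- + (x ℕ.* M) , Signed.∣m⇒∣-m (∣ᵤ⇒∣ (ℕ.n∣m*n x)) ,
  subst (+ N ∣_) (identity (+ (x ℕ.* M))) (Signed.∣m⇒∣-m
    (subst (λ k → + N ∣ + k) (sym 1+xM≡yN) (∣ᵤ⇒∣ (ℕ.n∣m*n y))))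
  where
  identity : ∀ k → ℤ.- (1ℤ ℤ.+ k) ≡ ℤ.- k ℤ.- 1ℤ
  identity = ℤ-Solver.solve-∀

chinese-remainder : ∀ {r M N} → Coprimality.Coprime M N → (b c : Vec ℤ r) →
                    ∃[ a ] a ≡ b [mod M ] × a ≡ c [mod N ]
chinese-remainder {M = M} {N} M⊥N b c = go (idempotent M⊥N) b c
  where
  left : ∀ u b c → u ℤ.* (c ℤ.- b) ≡ b ℤ.+ u ℤ.* (c ℤ.- b) ℤ.- b
  left = ℤ-Solver.solve-∀
  right : ∀ u b c → (u ℤ.- 1ℤ) ℤ.* (c ℤ.- b) ≡ b ℤ.+ u ℤ.* (c ℤ.- b) ℤ.- c
  right = ℤ-Solver.solve-∀
  go : (∃[ u ] + M ∣ u × + N ∣ u ℤ.- 1ℤ) → ∀ {r} (b c : Vec ℤ r) →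
       ∃[ a ] a ≡ b [mod M ] × a ≡ c [mod N ]
  go _                       []      []      = [] , [] , []
  go h@(u , M∣u , N∣u-1) (b ∷ bs) (c ∷ cs) with go h bs cs
  -- As `u` is 0 modulo `M` and 1 modulo `N`, this interpolates between `b` and `c`.
  ... | as , as≡bs , as≡cs = b ℤ.+ u ℤ.* (c ℤ.- b) ∷ as ,
    subst (+ M ∣_) (left u b c) (∣m⇒∣m*n _ M∣u) ∷ as≡bs ,
    subst (+ N ∣_) (right u b c) (∣m⇒∣m*n _ N∣u-1) ∷ as≡cs

≡-mod-trans : ∀ {r M N} {a b c : Vec ℤ r} → N ℕ.∣ M →
              a ≡ b [mod M ] → b ≡ c [mod N ] → a ≡ c [mod N ]
≡-mod-trans {N = N} N∣M = Pointwise.trans λ {x} {y} {z} M∣x-y N∣y-z →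
  subst (+ N ∣_) (telescope x y z) (∣m∣n⇒∣m+n (∣-trans (∣ᵤ⇒∣ N∣M) M∣x-y) N∣y-z)
  where
  telescope : ∀ x y z → (x ℤ.- y) ℤ.+ (y ℤ.- z) ≡ x ℤ.- z
  telescope = ℤ-Solver.solve-∀

∣-foldr-gcd : ∀ {s k} (v : Vector ℤ s) → k ℕ.∣ ℤ.∣ foldr gcd 0ℤ v ∣ → ∀ i → k ℕ.∣ ℤ.∣ v i ∣
∣-foldr-gcd v k∣d zero    = ℕ.∣-trans k∣d (ℕ.gcd[m,n]∣m ℤ.∣ v zero ∣ _)
∣-foldr-gcd v k∣d (suc i) = ∣-foldr-gcd (v ∘ suc) (ℕ.∣-trans k∣d (ℕ.gcd[m,n]∣n ℤ.∣ v zero ∣ _)) i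

foldr-gcd-greatest : ∀ {s k} (v : Vector ℤ s) →
                     (∀ i → k ℕ.∣ ℤ.∣ v i ∣) → k ℕ.∣ ℤ.∣ foldr gcd 0ℤ v ∣
foldr-gcd-greatest {zero}  {k} v k∣v = k ℕ.∣0
foldr-gcd-greatest {suc s} v k∣v =
  ℕ.gcd-greatest (k∣v zero) (foldr-gcd-greatest (v ∘ suc) (k∣v ∘ suc))

foldr-gcd-nonNegative : ∀ {s} (v : Vector ℤ s) → + ℤ.∣ foldr gcd 0ℤ v ∣ ≡ foldr gcd 0ℤ v
foldr-gcd-nonNegative {zero}  v = refl
foldr-gcd-nonNegative {suc s} v = refl

module _ {r s} (P : Vector (ℤPolynomial r) s) where

  d : Vec ℤ r → ℕ
  d n = ℤ.∣ gcdOfValues r P n ∣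

  +d≡gcdOfValues : ∀ n → + d n ≡ gcdOfValues r P n
  +d≡gcdOfValues n = foldr-gcd-nonNegative (λ i → evaluate r (P i) n)

  -- The values of each `P i` at the two points differ by a multiple of `M`, so a divisor of `M`
  -- divides all of them at one point exactly when it does at the other.
  d-mod : ∀ {M n n′} → n ≡ n′ [mod M ] → ℕ.gcd (d n) M ≡ ℕ.gcd (d n′) M
  d-mod {M} {n} {n′} n≡n′ = gcd-cong
    (λ {k} k∣M k∣dn → foldr-gcd-greatest (λ i → evaluate r (P i) n′) λ i →
      ∣⇒∣ᵤ {+ k} (∣-congruent (evaluate r (P i) n) (evaluate r (P i) n′)
        (∣-trans (∣ᵤ⇒∣ k∣M) (evaluate-mod r (P i) n≡n′))
        (∣ᵤ⇒∣ (∣-foldr-gcd (λ i → evaluate r (P i) n) k∣dn i))))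
    (λ {k} k∣M k∣dn′ → foldr-gcd-greatest (λ i → evaluate r (P i) n) λ i →
      ∣⇒∣ᵤ {+ k} (Signed.∣m+n∣n⇒∣m {m = evaluate r (P i) n}
        (∣-trans (∣ᵤ⇒∣ k∣M) (evaluate-mod r (P i) n≡n′))
        (Signed.∣m⇒∣-m (∣ᵤ⇒∣ (∣-foldr-gcd (λ i → evaluate r (P i) n′) k∣dn′ i)))))

  -- M = B² rather than B, so that gcd (d n) M reveals every p-adic
  -- valuation of d n.
  realize : ∀ {β B N₁ N₂ T} → Approximable r (List.tabulate P) β →
    β ℕ.∣ B → B ≢ 0 → N₁ ℕ.* N₂ ≡ B ℕ.* B → Coprimality.Coprime N₁ N₂ → T ℕ.∣ B →
    ∀ b c → ℕ.gcd (d b) N₁ ℕ.* ℕ.gcd (d c) N₂ ≡ T → + T ∈ 𝒟 r P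
  realize {β} {B} {N₁} {N₂} {T} approximable β∣B B≢0 N₁N₂≡M N₁⊥N₂ T∣B b c split≡T =
    from-residue (chinese-remainder N₁⊥N₂ b c)
    where
    M = B ℕ.* B
    M≢0 : M ≢ 0
    M≢0 M≡0 = Sum.[ B≢0 , B≢0 ] (ℕ.m*n≡0⇒m≡0∨n≡0 B M≡0)

    from-point : ∀ {a} → a ≡ b [mod N₁ ] → a ≡ c [mod N₂ ] →
                 Approximation r (List.tabulate P) M a (CommutativeRing.1# (ring r)) → + T ∈ 𝒟 r P
    from-point a≡b a≡c approximation = n , trans (sym (+d≡gcdOfValues n)) (cong +_
      (determined-by-gcd B≢0 T∣B gcd≡T λ p-prime p∣dn → common-prime∣ p-prime
        (All.tabulate⁺ λ i → ∣ᵤ⇒∣ (∣-foldr-gcd (λ i → evaluate r (P i) n) p∣dn i))))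
      where
      open Approximation approximation renaming (point to n)
      open ≡-Reasoning
      gcd-part : ∀ {N a′} → N ℕ.∣ M → n ≡ a′ [mod N ] → ℕ.gcd (ℕ.gcd (d n) M) N ≡ ℕ.gcd (d a′) N
      gcd-part N∣M n≡a′ = trans
        (gcd-cong (λ _ k∣g → ℕ.∣-trans k∣g (ℕ.gcd[m,n]∣m (d n) M))
                  (λ k∣N k∣dn → ℕ.gcd-greatest k∣dn (ℕ.∣-trans k∣N N∣M)))
        (d-mod n≡a′)
      N₁∣M = subst (N₁ ℕ.∣_) N₁N₂≡M (ℕ.m∣m*n N₂)
      N₂∣M = subst (N₂ ℕ.∣_) N₁N₂≡M (ℕ.n∣m*n N₁)
      gcd≡T : ℕ.gcd (d n) M ≡ T
      -- The gcd with `M` is the product of its parts at `N₁` and `N₂`, which depend only on the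
      -- residues of `n`; these are the residues of `b` and of `c`.
      gcd≡T = begin
        ℕ.gcd (d n) M
          ≡⟨ gcd-*-gcd N₁⊥N₂ (subst (ℕ.gcd (d n) M ℕ.∣_) (sym N₁N₂≡M) (ℕ.gcd[m,n]∣n (d n) M)) ⟨
        ℕ.gcd (ℕ.gcd (d n) M) N₁ ℕ.* ℕ.gcd (ℕ.gcd (d n) M) N₂
          ≡⟨ cong₂ ℕ._*_ (gcd-part N₁∣M (≡-mod-trans N₁∣M point≡a a≡b))
                         (gcd-part N₂∣M (≡-mod-trans N₂∣M point≡a a≡c)) ⟩
        ℕ.gcd (d b) N₁ ℕ.* ℕ.gcd (d c) N₂
          ≡⟨ split≡T ⟩
        T ∎

    from-residue : (∃[ a ] a ≡ b [mod N₁ ] × a ≡ c [mod N₂ ]) → + T ∈ 𝒟 r P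
    -- No further polynomial has to be kept nonzero at the final point, so `ε` is 1.
    from-residue (a , a≡b , a≡c) = from-point a≡b a≡c
      (approximable M≢0 (ℕ.∣-trans β∣B (ℕ.m∣m*n B)) a (CommutativeRing.1# (ring r))
        (Divisibility.IsFactorial.1≉0 (isFactorial r)))

  realize-gcd-lcm : ∀ {β} b c → β ≢ 0 → d b ≢ 0 → d c ≢ 0 →
    Approximable r (List.tabulate P) β →
    + ℕ.gcd (d b) (d c) ∈ 𝒟 r P × + ℕ.lcm (d b) (d c) ∈ 𝒟 r P
  realize-gcd-lcm {β} b c β≢0 db≢0 dc≢0 approximable =
    realize-splitting (gcd-lcm-splitting db≢0 (*-≢0 B≢0 B≢0)
      (∣M (ℕ.m∣m*n (d c))) (∣M (ℕ.n∣m*n (d b))))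
    where
    -- The factor `d b * d c` makes `B` a multiple of both the gcd and the lcm; `β` makes
    -- `approximable` apply to `B * B`.
    B = β ℕ.* (d b ℕ.* d c)
    ∣B : ∀ {k} → k ℕ.∣ d b ℕ.* d c → k ℕ.∣ B
    ∣B = ℕ.∣n⇒∣m*n β
    ∣M : ∀ {k} → k ℕ.∣ d b ℕ.* d c → k ℕ.∣ B ℕ.* B
    ∣M = ℕ.∣m⇒∣m*n B ∘ ∣B
    *-≢0 : ∀ {m n} → m ≢ 0 → n ≢ 0 → m ℕ.* n ≢ 0
    *-≢0 {m} m≢0 n≢0 mn≡0 = Sum.[ m≢0 , n≢0 ] (ℕ.m*n≡0⇒m≡0∨n≡0 m mn≡0)
    B≢0 : B ≢ 0
    B≢0 = *-≢0 β≢0 (*-≢0 db≢0 dc≢0)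
    realize-splitting : (∃[ N₁ ] ∃[ N₂ ] N₁ ℕ.* N₂ ≡ B ℕ.* B × Coprimality.Coprime N₁ N₂ ×
      ℕ.gcd (d c) N₁ ℕ.* ℕ.gcd (d b) N₂ ≡ ℕ.gcd (d b) (d c) ×
      ℕ.gcd (d b) N₁ ℕ.* ℕ.gcd (d c) N₂ ≡ ℕ.lcm (d b) (d c)) →
      + ℕ.gcd (d b) (d c) ∈ 𝒟 r P × + ℕ.lcm (d b) (d c) ∈ 𝒟 r P
    realize-splitting (N₁ , N₂ , N₁N₂≡M , N₁⊥N₂ , gcd-part , lcm-part) =
      -- For the gcd the point follows `c` modulo `N₁` and `b` modulo `N₂`; for the lcm the roles
      -- are exchanged.
      realize approximable (ℕ.m∣m*n (d b ℕ.* d c)) B≢0 N₁N₂≡M N₁⊥N₂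
        (∣B (ℕ.∣m⇒∣m*n (d c) (ℕ.gcd[m,n]∣m (d b) (d c)))) c b gcd-part ,
      realize approximable (ℕ.m∣m*n (d b ℕ.* d c)) B≢0 N₁N₂≡M N₁⊥N₂
        (∣B (ℕ.lcm-least {d b} {d c} (ℕ.m∣m*n (d c)) (ℕ.n∣m*n (d b)))) b c lcm-part

  gcd-lcm-realized : (∃[ β ] β ≢ 0 × Approximable r (List.tabulate P) β) → ∀ b c →
    gcd (gcdOfValues r P b) (gcdOfValues r P c) ∈ 𝒟 r P ×
    lcm (gcdOfValues r P b) (gcdOfValues r P c) ∈ 𝒟 r P
  gcd-lcm-realized (β , β≢0 , approximable) b c = by-cases (d b ℕ.≟ 0) (d c ℕ.≟ 0)
    where
    d∈𝒟 : ∀ n → + d n ∈ 𝒟 r P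
    d∈𝒟 n = n , sym (+d≡gcdOfValues n)
    by-cases : Dec (d b ≡ 0) → Dec (d c ≡ 0) →
      + ℕ.gcd (d b) (d c) ∈ 𝒟 r P × + ℕ.lcm (d b) (d c) ∈ 𝒟 r P
    -- The gcd with 0 is the other value, and the lcm with 0 is 0, which is `d b` itself.
    by-cases (yes db≡0) _ =
      subst (λ k → + ℕ.gcd k (d c) ∈ 𝒟 r P) (sym db≡0)
        (subst (λ k → + k ∈ 𝒟 r P) (sym (ℕ.gcd-identityˡ (d c))) (d∈𝒟 c)) ,
      subst (λ k → + k ∈ 𝒟 r P)
        (trans db≡0 (sym (trans (cong (λ k → ℕ.lcm k (d c)) db≡0) (ℕ.lcm[0,n]≡0 (d c))))) (d∈𝒟 b)
    by-cases (no _) (yes dc≡0) =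
      subst (λ k → + ℕ.gcd (d b) k ∈ 𝒟 r P) (sym dc≡0)
        (subst (λ k → + k ∈ 𝒟 r P) (sym (ℕ.gcd-identityʳ (d b))) (d∈𝒟 b)) ,
      subst (λ k → + k ∈ 𝒟 r P)
        (trans dc≡0 (sym (trans (cong (ℕ.lcm (d b)) dc≡0) (ℕ.lcm[n,0]≡0 (d b))))) (d∈𝒟 c)
    by-cases (no db≢0) (no dc≢0) = realize-gcd-lcm b c β≢0 db≢0 dc≢0 approximable

theorem1p1 : (r s : ℕ) → r ≥ 1 → s ≥ 2 →
    (P : Vector (ℤPolynomial r) s) →
    (∀ i → NonZeroPolynomial r (P i)) →
    CoprimePolynomials r P →
    (d d′ : ℤ) → d ∈ 𝒟 r P → d′ ∈ 𝒟 r P →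
    (gcd d d′ ∈ 𝒟 r P) × (lcm d d′ ∈ 𝒟 r P)
theorem1p1 r (suc s) _ _ P P≉0 coprime _ _ (b , refl) (c , refl) = gcd-lcm-realized P
  (approximate r (List.tabulate P) (Any.tabulate⁺ {f = P} zero (P≉0 zero))
    (coprime-tabulate r P coprime))
  b c
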